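{- Let $G$ be a finite simple graph with maximum degree $\Delta\geq 3$, let $P$ be a solvable pebble distribution on $G$, and let $U_1,\dots,U_t$ be the decomposition of $P$ into unit distributions (one for each vertex $u$ with $P(u)>0$, placing $P(u)$ pebbles on $u$), ordered so that $|U_i|\leq|U_{i+1}|$. Then $$\sum_{i=1}^t\mathrm{CE}\Big(\sum_{k=1}^{i-1}U_k,\,U_i\Big)\;\geq\;\frac{|V(G)|-\sum_{i=1}^t\mathrm{cov}(U_i)}{\Delta-2},$$ where the empty sum $\sum_{k=1}^{0}U_k$ is the empty distribution.
   Context: A pebble distribution $P$ on $G$ is a function $V(G)\to\mathbb{Z}_{\geq 0}$, $|P|=\sum_vP(v)$, and $(P+Q)(v)=P(v)+Q(v)$. A pebbling move from a vertex with at least two pebbles to a neighbor removes two pebbles from the first and adds one to the neighbor. A vertex $v$ is $k$-reachable under $P$ if some sequence of pebbling moves (keeping all counts nonnegative) yields at least $k$ pebbles on $v$; reachable means $1$-reachable; $P$ is solvable if every vertex is reachable. $\mathrm{reach}(P,v)$ is the largest such $k$; $\mathrm{exc}(P,v)=\mathrm{reach}(P,v)-1$ if $v$ is reachable and $0$ otherwise; $\mathrm{TE}(P)=\sum_v\mathrm{exc}(P,v)$. A unit distribution has pebbles on only one vertex. $\mathrm{cov}(P)$ is the number of vertices reachable under $P$. The cooperation excess is $\mathrm{CE}(P,Q)=\mathrm{TE}(P+Q)-\mathrm{TE}(P)-\mathrm{TE}(Q)$. -}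

module Defs where

open import Data.Nat using (ℕ; zero; suc; _+_; _*_; _∸_; _≤_; _<_)
open import Data.Bool using (Bool; true; false; if_then_else_)
open import Data.Fin using (Fin)
open import Data.Fin.Properties using (_≟_)
open import Data.List using (List; []; _∷_; map; allFin)
open import Data.Nat.ListAction using (sum)
open import Data.Product using (Σ; ∃; _×_; _,_)
open import Data.Integer as ℤ using (ℤ; +_)
open import Relation.Nullary using (¬_; does)
open import Relation.Binary.PropositionalEquality using (_≡_)
open import Relation.Binary.Construct.Closure.ReflexiveTransitive using (Star)

record Graph (n : ℕ) : Set where
  field
    adj   : Fin n → Fin n → Bool
    sym   : ∀ u v → adj u v ≡ adj v u
    irrefl : ∀ v → adj v v ≡ false
open Graph public

Σᵥ : {n : ℕ} → (Fin n → ℕ) → ℕ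
Σᵥ {n} f = sum (map f (allFin n))

degree : {n : ℕ} → Graph n → Fin n → ℕ
degree G v = Σᵥ (λ w → if adj G v w then 1 else 0)

IsMaxDegree : {n : ℕ} → Graph n → ℕ → Set
IsMaxDegree G Δ = (∀ v → degree G v ≤ Δ) × ∃ λ v → degree G v ≡ Δ

Dist : ℕ → Set
Dist n = Fin n → ℕ

_⊕_ : {n : ℕ} → Dist n → Dist n → Dist n
(P ⊕ Q) v = P v + Q v

size : {n : ℕ} → Dist n → ℕ
size P = Σᵥ P

empty : {n : ℕ} → Dist n
empty _ = 0

unit : {n : ℕ} → Fin n → ℕ → Dist n
unit u k x = if does (u ≟ x) then k else 0

moved : {n : ℕ} → Dist n → Fin n → Fin n → Dist n
moved P u w x =
  if does (u ≟ x) then P x ∸ 2 else (if does (w ≟ x) then suc (P x) else P x)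

data Move {n : ℕ} (G : Graph n) (P Q : Dist n) : Set where
  move : (u w : Fin n) → adj G u w ≡ true → 2 ≤ P u →
         (∀ x → Q x ≡ moved P u w x) → Move G P Q

_⊢_⇝*_ : {n : ℕ} → Graph n → Dist n → Dist n → Set
G ⊢ P ⇝* Q = Star (Move G) P Q

Reachable : {n : ℕ} → Graph n → Dist n → Fin n → ℕ → Set
Reachable G P v k = ∃ λ Q → G ⊢ P ⇝* Q × k ≤ Q v

Solvable : {n : ℕ} → Graph n → Dist n → Set
Solvable G P = ∀ v → Reachable G P v 1

IsReachFn : {n : ℕ} → Graph n → (Dist n → Fin n → ℕ) → Set
IsReachFn G rch = ∀ P v →
  Reachable G P v (rch P v) × (∀ k → Reachable G P v k → k ≤ rch P v)

module WithReach {n : ℕ} (rch : Dist n → Fin n → ℕ) where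
  -- exc(P,v) = reach(P,v) − 1 if reachable (reach ≥ 1), else 0
  exc : Dist n → Fin n → ℕ
  exc P v = rch P v ∸ 1

  TE : Dist n → ℕ
  TE P = Σᵥ (exc P)

  cov : Dist n → ℕ
  cov P = Σᵥ (λ v → if does (1 Data.Nat.≤? rch P v) then 1 else 0)

  CE : Dist n → Dist n → ℤ
  CE P Q = (+ TE (P ⊕ Q)) ℤ.- (+ TE P) ℤ.- (+ TE Q)

  -- Σᵢ CE(U₁+…+U_{i-1}, Uᵢ), where the units are placed on the listed
  -- vertices in order, Uᵢ = P(usᵢ) pebbles on usᵢ.
  ceSumFrom : Dist n → Dist n → List (Fin n) → ℤ
  ceSumFrom P acc [] = + 0
  ceSumFrom P acc (u ∷ us) =
    CE acc (unit u (P u)) ℤ.+ ceSumFrom P (acc ⊕ unit u (P u)) us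

  ceSum : Dist n → List (Fin n) → ℤ
  ceSum P us = ceSumFrom P empty us

  covSum : Dist n → List (Fin n) → ℕ
  covSum P us = sum (map (λ u → cov (unit u (P u))) us)

{-# OPTIONS --safe #-}

-- The cooperation excesses telescope to TE(P) - Σᵢ TE(Uᵢ), so the order of the units is
-- irrelevant.  Put D = Δ - 2, let r be the reach under P, ρᵥ the reach under the unit on v, and m
-- the number of units reaching x.  After exchanging sums the claim is that the local budgets
-- D (r - 1 - Σᵥ (ρᵥ - 1)⁺) + m - 1 add up to at least 0, and this is shown by discharging.
--
-- For every x fix a shortest move sequence bringing r x pebbles to x; it never moves pebbles away
-- from x.  Let c x y be the number of its moves from y to x.  Keeping the pebbles that y would
-- give, and sending half of the others back, shows r y ≥ 2 c x y + ⌊(r x - c x y) / 2⌋.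
-- A vertex x pays y when y depends on x: if no unit reaches y then x pays c y x when r y ≤ 2, and
-- 2 when r y ≥ 3 and x supplies everything that y receives; if exactly one unit reaches y and
-- r y exceeds its contribution, x pays 1 when it is the only supplier.  By the exchange inequality
-- x hardly ever pays a vertex that supplies x, so x has a neighbour that it pays nothing, and with
-- at most Δ neighbours the payments of x stay within its budget and income.

module Submission where

open import Defs
open import Data.Nat hiding (_≟_)
open import Data.Nat.DivMod using (m≡m%n+[m/n]*n; m%n<n)
open import Data.Nat.Induction using (<-rec)
open import Data.Nat.ListAction using (sum)
open import Data.Nat.Properties hiding (_≟_)
import Data.Nat.Properties as ℕₚ
open import Data.Nat.Tactic.RingSolver using (solve-∀)
open import Data.Bool using (true; if_then_else_)
import Data.Bool.Properties as Bool
open import Data.Empty using (⊥; ⊥-elim)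
open import Data.Fin using (Fin; zero; suc)
open import Data.Fin.Patterns
open import Data.Fin.Properties using (_≟_; any?; all?)
open import Data.List using (List; []; _∷_; map; allFin)
open import Data.List.Membership.Propositional using (_∈_; _∉_)
open import Data.List.Properties using (map-tabulate)
open import Data.List.Relation.Unary.All as All using (All)
open import Data.List.Relation.Unary.AllPairs using ([]; _∷_)
open import Data.List.Relation.Unary.Any using (here; there)
open import Data.List.Relation.Unary.Linked using (Linked)
open import Data.List.Relation.Unary.Unique.Propositional using (Unique)
open import Data.Product using (∃; ∃₂; _×_; _,_; proj₁; proj₂)
open import Data.Sum using (_⊎_; inj₁; inj₂; [_,_]′)
open import Data.Vec as Vec using (Vec; []; _∷_)
open import Function using (_∘_; case_of_)
open import Function.Bundles using (_⇔_; Equivalence)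
open import Relation.Binary.Construct.Closure.ReflexiveTransitive using (ε; _◅_; _◅◅_)
open import Relation.Binary.PropositionalEquality as Eq
  using (_≡_; _≢_; refl; trans; cong; cong₂; subst; subst₂; ≢-sym; module ≡-Reasoning)
open import Relation.Nullary using (¬_; Dec; yes; no; does; contradiction)
open import Relation.Nullary.Decidable using (True; toWitness; _×-dec_; _⊎-dec_; ¬?; map′)

private variable
  n k ℓ : ℕ

-- Sums over Fin n

Σᵥ-suc : (f : Fin (suc n) → ℕ) → Σᵥ f ≡ f zero + Σᵥ (f ∘ suc)
Σᵥ-suc {n} f = cong (λ l → f zero + sum l)
  (trans (map-tabulate suc f) (Eq.sym (map-tabulate (λ i → i) (f ∘ suc))))

Σ-cong : {f g : Fin n → ℕ} → (∀ i → f i ≡ g i) → Σᵥ f ≡ Σᵥ g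
Σ-cong {zero}  h = refl
Σ-cong {suc n} {f} {g} h =
  trans (Σᵥ-suc f) (trans (cong₂ _+_ (h zero) (Σ-cong (h ∘ suc))) (Eq.sym (Σᵥ-suc g)))

Σ-mono : {f g : Fin n → ℕ} → (∀ i → f i ≤ g i) → Σᵥ f ≤ Σᵥ g
Σ-mono {zero}  h = z≤n
Σ-mono {suc n} {f} {g} h =
  subst₂ _≤_ (Eq.sym (Σᵥ-suc f)) (Eq.sym (Σᵥ-suc g)) (+-mono-≤ (h zero) (Σ-mono (h ∘ suc)))

Σ-const : (a : ℕ) → Σᵥ {n} (λ _ → a) ≡ n * a
Σ-const {zero}  a = refl
Σ-const {suc n} a = trans (Σᵥ-suc {n} (λ _ → a)) (cong (a +_) (Σ-const {n} a))

Σ-+ : (f g : Fin n → ℕ) → Σᵥ (λ i → f i + g i) ≡ Σᵥ f + Σᵥ g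
Σ-+ {zero}  f g = refl
Σ-+ {suc n} f g = begin
  Σᵥ (λ i → f i + g i)                                       ≡⟨ Σᵥ-suc (λ i → f i + g i) ⟩
  f zero + g zero + Σᵥ (λ i → f (suc i) + g (suc i))         ≡⟨ cong (f zero + g zero +_) (Σ-+ (f ∘ suc) (g ∘ suc)) ⟩
  f zero + g zero + (Σᵥ (f ∘ suc) + Σᵥ (g ∘ suc))            ≡⟨ swap (f zero) (g zero) _ _ ⟩
  f zero + Σᵥ (f ∘ suc) + (g zero + Σᵥ (g ∘ suc))            ≡⟨ Eq.sym (cong₂ _+_ (Σᵥ-suc f) (Σᵥ-suc g)) ⟩
  Σᵥ f + Σᵥ g                                                ∎
  where
  open ≡-Reasoning
  swap : ∀ a b c d → a + b + (c + d) ≡ a + c + (b + d)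
  swap = solve-∀

Σ-* : (a : ℕ) (f : Fin n → ℕ) → Σᵥ (λ i → a * f i) ≡ a * Σᵥ f
Σ-* {zero}  a f = Eq.sym (*-zeroʳ a)
Σ-* {suc n} a f = begin
  Σᵥ (λ i → a * f i)                     ≡⟨ Σᵥ-suc (λ i → a * f i) ⟩
  a * f zero + Σᵥ (λ i → a * f (suc i))  ≡⟨ cong (a * f zero +_) (Σ-* a (f ∘ suc)) ⟩
  a * f zero + a * Σᵥ (f ∘ suc)          ≡⟨ Eq.sym (*-distribˡ-+ a (f zero) _) ⟩
  a * (f zero + Σᵥ (f ∘ suc))            ≡⟨ cong (a *_) (Eq.sym (Σᵥ-suc f)) ⟩
  a * Σᵥ f                               ∎
  where open ≡-Reasoning

Σ-swap : {p : ℕ} (f : Fin n → Fin p → ℕ) → Σᵥ (λ i → Σᵥ (f i)) ≡ Σᵥ (λ j → Σᵥ (λ i → f i j))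
Σ-swap {zero}  {p} f = Eq.sym (trans (Σ-const {p} 0) (*-zeroʳ p))
Σ-swap {suc n} f = begin
  Σᵥ (λ i → Σᵥ (f i))                                  ≡⟨ Σᵥ-suc (λ i → Σᵥ (f i)) ⟩
  Σᵥ (f zero) + Σᵥ (λ i → Σᵥ (f (suc i)))              ≡⟨ cong (Σᵥ (f zero) +_) (Σ-swap (f ∘ suc)) ⟩
  Σᵥ (f zero) + Σᵥ (λ j → Σᵥ (λ i → f (suc i) j))      ≡⟨ Eq.sym (Σ-+ (f zero) _) ⟩
  Σᵥ (λ j → f zero j + Σᵥ (λ i → f (suc i) j))         ≡⟨ Σ-cong (λ j → Eq.sym (Σᵥ-suc (λ i → f i j))) ⟩
  Σᵥ (λ j → Σᵥ (λ i → f i j))                          ∎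
  where open ≡-Reasoning

δ : Fin n → Fin n → ℕ
δ i j = if does (i ≟ j) then 1 else 0

_∖_ : (Fin n → ℕ) → Fin n → Fin n → ℕ
(f ∖ i) j = if does (i ≟ j) then 0 else f j

∖-≢ : (f : Fin n → ℕ) {i j : Fin n} → i ≢ j → (f ∖ i) j ≡ f j
∖-≢ f {i} {j} i≢j with i ≟ j
... | yes i≡j = contradiction i≡j i≢j
... | no _    = refl

Σ-split : (f : Fin n → ℕ) (i : Fin n) → Σᵥ f ≡ f i + Σᵥ (f ∖ i)
Σ-split {suc n} f zero =
  trans (Σᵥ-suc f) (cong (f zero +_) (Eq.sym (Σᵥ-suc (f ∖ zero))))
Σ-split {suc n} f (suc i) = begin
  Σᵥ f                                             ≡⟨ Σᵥ-suc f ⟩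
  f zero + Σᵥ (f ∘ suc)                            ≡⟨ cong (f zero +_) (Σ-split (f ∘ suc) i) ⟩
  f zero + (f (suc i) + Σᵥ ((f ∘ suc) ∖ i))        ≡⟨ swap (f zero) (f (suc i)) _ ⟩
  f (suc i) + (f zero + Σᵥ ((f ∘ suc) ∖ i))        ≡⟨ cong (f (suc i) +_) (cong (f zero +_) (Σ-cong off)) ⟩
  f (suc i) + (f zero + Σᵥ ((f ∖ suc i) ∘ suc))    ≡⟨ cong (f (suc i) +_) (Eq.sym (Σᵥ-suc (f ∖ suc i))) ⟩
  f (suc i) + Σᵥ (f ∖ suc i)                       ∎
  where
  open ≡-Reasoning
  swap : ∀ a b c → a + (b + c) ≡ b + (a + c)
  swap = solve-∀
  off : ∀ j → ((f ∘ suc) ∖ i) j ≡ (f ∖ suc i) (suc j)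
  off j with i ≟ j
  ... | yes _ = refl
  ... | no _  = refl

Σ-δ : (f : Fin n → ℕ) (i : Fin n) → Σᵥ (λ j → f j * δ i j) ≡ f i
Σ-δ {n} f i = begin
  Σᵥ g                     ≡⟨ Σ-split g i ⟩
  g i + Σᵥ (g ∖ i)         ≡⟨ cong₂ _+_ at (trans (Σ-cong off) (trans (Σ-const {n} 0) (*-zeroʳ n))) ⟩
  f i + 0                  ≡⟨ +-identityʳ (f i) ⟩
  f i                      ∎
  where
  open ≡-Reasoning
  g = λ j → f j * δ i j
  at : g i ≡ f i
  at with i ≟ i
  ... | yes _  = *-identityʳ (f i)
  ... | no i≢i = contradiction refl i≢i
  off : ∀ j → (g ∖ i) j ≡ 0
  off j with i ≟ j
  ... | yes _ = refl
  ... | no _  = *-zeroʳ (f j)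

Σ-δ₁ : (i : Fin n) → Σᵥ (δ i) ≡ 1
Σ-δ₁ i = trans (Σ-cong (λ j → Eq.sym (+-identityʳ (δ i j)))) (Σ-δ (λ _ → 1) i)

Σ-≥ : (f : Fin n → ℕ) (i : Fin n) → f i ≤ Σᵥ f
Σ-≥ f i = ≤-trans (m≤m+n (f i) _) (≤-reflexive (Eq.sym (Σ-split f i)))

-- Only the terms off `i` are compared, so the slack `g i - f i` survives in the sum. With `f` the
-- payments of a vertex and `g` a cap on them, a neighbour paid little lowers the bound on the
-- total.
Σ-mono-at : {f g : Fin n → ℕ} → (∀ i → f i ≤ g i) → (i : Fin n) → Σᵥ f + g i ≤ f i + Σᵥ g
Σ-mono-at {f = f} {g} h i = begin
  Σᵥ f + g i                  ≡⟨ cong (_+ g i) (Σ-split f i) ⟩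
  f i + Σᵥ (f ∖ i) + g i      ≤⟨ +-monoˡ-≤ (g i) (+-monoʳ-≤ (f i) (Σ-mono off)) ⟩
  f i + Σᵥ (g ∖ i) + g i      ≡⟨ swap (f i) (Σᵥ (g ∖ i)) (g i) ⟩
  f i + (g i + Σᵥ (g ∖ i))    ≡⟨ cong (f i +_) (Eq.sym (Σ-split g i)) ⟩
  f i + Σᵥ g                  ∎
  where
  open ≤-Reasoning
  swap : ∀ a b c → a + b + c ≡ a + (c + b)
  swap = solve-∀
  off : ∀ j → (f ∖ i) j ≤ (g ∖ i) j
  off j with i ≟ j
  ... | yes _ = z≤n
  ... | no _  = h j

Σ-mono-at₂ : {f g : Fin n → ℕ} → (∀ i → f i ≤ g i) → {i j : Fin n} → i ≢ j →
             Σᵥ f + (g i + g j) ≤ f i + f j + Σᵥ g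
Σ-mono-at₂ {f = f} {g} h {i} {j} i≢j = begin
  Σᵥ f + (g i + g j)                       ≡⟨ cong (_+ (g i + g j)) (Σ-split f i) ⟩
  f i + Σᵥ (f ∖ i) + (g i + g j)           ≡⟨ swap (f i) (Σᵥ (f ∖ i)) (g i) (g j) ⟩
  f i + g i + (Σᵥ (f ∖ i) + g j)           ≤⟨ +-monoʳ-≤ (f i + g i) rest ⟩
  f i + g i + (f j + Σᵥ (g ∖ i))           ≡⟨ swap (f i) (g i) (f j) (Σᵥ (g ∖ i)) ⟩
  f i + f j + (g i + Σᵥ (g ∖ i))           ≡⟨ cong (f i + f j +_) (Eq.sym (Σ-split g i)) ⟩
  f i + f j + Σᵥ g                         ∎
  where
  open ≤-Reasoning
  swap : ∀ a b c d → a + b + (c + d) ≡ a + c + (b + d)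
  swap = solve-∀
  off : ∀ z → (f ∖ i) z ≤ (g ∖ i) z
  off z with i ≟ z
  ... | yes _ = z≤n
  ... | no _  = h z
  rest : Σᵥ (f ∖ i) + g j ≤ f j + Σᵥ (g ∖ i)
  rest = subst₂ (λ a b → Σᵥ (f ∖ i) + a ≤ b + Σᵥ (g ∖ i)) (∖-≢ g i≢j) (∖-≢ f i≢j) (Σ-mono-at off j)

Σ-pos : (f : Fin n → ℕ) → 1 ≤ Σᵥ f → ∃ λ i → 1 ≤ f i
Σ-pos {suc n} f h with 1 ≤? f zero
... | yes p = zero , p
... | no ¬p with Σ-pos (f ∘ suc) (subst (1 ≤_) (trans (Σᵥ-suc f) (cong (_+ Σᵥ (f ∘ suc)) (n<1⇒n≡0 (≰⇒> ¬p)))) h)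
...   | i , q = suc i , q

-- Applied to the supplies of a vertex, this separates a sole supplier from two different suppliers,
-- the basic alternative of the discharging.
Σ-concentrated-or-spread : (f : Fin n → ℕ) → 1 ≤ Σᵥ f →
  (∃ λ i → f i ≡ Σᵥ f) ⊎ (∃₂ λ i j → i ≢ j × 1 ≤ f i × 1 ≤ f j)
Σ-concentrated-or-spread f h with Σ-pos f h
... | i , p with Σᵥ (f ∖ i) in eq
...   | zero  = inj₁ (i , Eq.sym (trans (Σ-split f i) (trans (cong (f i +_) eq) (+-identityʳ (f i)))))
...   | suc _ with Σ-pos (f ∖ i) (subst (1 ≤_) (Eq.sym eq) (s≤s z≤n))
...     | j , q with i ≟ j
...       | no i≢j = inj₂ (i , j , i≢j , p , q)

-- Linear arithmetic by Farkas certificates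

data Lin (k : ℕ) : Set where
  con  : ℕ → Lin k
  var  : Fin k → Lin k
  _:+_ : Lin k → Lin k → Lin k
  _:*_ : ℕ → Lin k → Lin k

infixl 6 _:+_
infixr 7 _:*_

⟦_⟧ : Lin k → Vec ℕ k → ℕ
⟦ con a ⟧  vs = a
⟦ var i ⟧  vs = Vec.lookup vs i
⟦ e :+ f ⟧ vs = ⟦ e ⟧ vs + ⟦ f ⟧ vs
⟦ a :* e ⟧ vs = a * ⟦ e ⟧ vs

coeff : Lin k → Fin k → ℕ
coeff (con a)  j = 0
coeff (var i)  j = δ i j
coeff (e :+ f) j = coeff e j + coeff f j
coeff (a :* e) j = a * coeff e j

const : Lin k → ℕ
const (con a)  = a
const (var i)  = 0
const (e :+ f) = const e + const f
const (a :* e) = a * const e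

linear : Lin k → Vec ℕ k → ℕ
linear e vs = Σᵥ (λ j → coeff e j * Vec.lookup vs j)

⟦⟧-normal : (e : Lin k) (vs : Vec ℕ k) → ⟦ e ⟧ vs ≡ const e + linear e vs
⟦⟧-normal {k} (con a) vs =
  Eq.sym (trans (cong (a +_) (trans (Σ-const {k} 0) (*-zeroʳ k))) (+-identityʳ a))
⟦⟧-normal (var i) vs =
  Eq.sym (trans (Σ-cong (λ j → *-comm (δ i j) (Vec.lookup vs j))) (Σ-δ (Vec.lookup vs) i))
⟦⟧-normal (e :+ f) vs = begin
  ⟦ e ⟧ vs + ⟦ f ⟧ vs
    ≡⟨ cong₂ _+_ (⟦⟧-normal e vs) (⟦⟧-normal f vs) ⟩
  const e + linear e vs + (const f + linear f vs)
    ≡⟨ interchange (const e) (linear e vs) (const f) (linear f vs) ⟩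
  const e + const f + (linear e vs + linear f vs)
    ≡⟨ cong (const e + const f +_) (Eq.sym (Σ-+ _ (λ j → coeff f j * Vec.lookup vs j))) ⟩
  const e + const f + Σᵥ (λ j → coeff e j * Vec.lookup vs j + coeff f j * Vec.lookup vs j)
    ≡⟨ cong (const e + const f +_) (Σ-cong (λ j → Eq.sym (*-distribʳ-+ (Vec.lookup vs j) (coeff e j) (coeff f j)))) ⟩
  const e + const f + linear (e :+ f) vs ∎
  where
  open ≡-Reasoning
  interchange : ∀ a b c d → a + b + (c + d) ≡ a + c + (b + d)
  interchange = solve-∀
⟦⟧-normal (a :* e) vs = begin
  a * ⟦ e ⟧ vs                                                   ≡⟨ cong (a *_) (⟦⟧-normal e vs) ⟩
  a * (const e + linear e vs)                                    ≡⟨ *-distribˡ-+ a (const e) _ ⟩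
  a * const e + a * linear e vs                                  ≡⟨ cong (a * const e +_) (Eq.sym (Σ-* a (λ j → coeff e j * Vec.lookup vs j))) ⟩
  a * const e + Σᵥ (λ j → a * (coeff e j * Vec.lookup vs j))     ≡⟨ cong (a * const e +_) (Σ-cong (λ j → Eq.sym (*-assoc a (coeff e j) _))) ⟩
  a * const e + linear (a :* e) vs                               ∎
  where open ≡-Reasoning

-- A decidable sufficient condition: the variables range over natural numbers, so comparing
-- constants and coefficients settles the inequality at every valuation.
_≼_ : Lin k → Lin k → Set
e ≼ f = const e ≤ const f × (∀ j → coeff e j ≤ coeff f j)

_≼?_ : (e f : Lin k) → Dec (e ≼ f)
e ≼? f = (const e ≤? const f) ×-dec all? (λ j → coeff e j ≤? coeff f j)

≼-sound : (e f : Lin k) → e ≼ f → ∀ vs → ⟦ e ⟧ vs ≤ ⟦ f ⟧ vs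
≼-sound e f (p , q) vs =
  subst₂ _≤_ (Eq.sym (⟦⟧-normal e vs)) (Eq.sym (⟦⟧-normal f vs))
    (+-mono-≤ p (Σ-mono (λ j → *-monoˡ-≤ (Vec.lookup vs j) (q j))))

record Fact (vs : Vec ℕ k) : Set where
  constructor _⊑_by_
  field
    lhs rhs : Lin k
    holds   : ⟦ lhs ⟧ vs ≤ ⟦ rhs ⟧ vs

infix 4 _⊑_by_
infixr 3 _⊞_
infixr 5 _⊠_

_⊞_ : {vs : Vec ℕ k} → Fact vs → Fact vs → Fact vs
(a ⊑ b by p) ⊞ (c ⊑ d by q) = a :+ c ⊑ b :+ d by +-mono-≤ p q

_⊠_ : {vs : Vec ℕ k} → ℕ → Fact vs → Fact vs
m ⊠ (a ⊑ b by p) = m :* a ⊑ m :* b by *-monoʳ-≤ m p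

-- The summed facts L ≤ R certify a ≤ b when (1+s)·a + R is coefficientwise at most
-- (1+s)·b + s + L; the s accounts for rounding after division by 1 + s.
farkas : {vs : Vec ℕ k} (s : ℕ) (h : Fact vs) (a b : Lin k) →
         {True ((suc s :* a :+ Fact.rhs h) ≼? (suc s :* b :+ con s :+ Fact.lhs h))} →
         ⟦ a ⟧ vs ≤ ⟦ b ⟧ vs
farkas {vs = vs} s (L ⊑ R by L≤R) a b {ok} =
  ≮⇒≥ (λ b<a → <-irrefl refl (begin-strict
    suc s * ⟦ b ⟧ vs + s               <⟨ m<m+n _ (s≤s z≤n) ⟩
    suc s * ⟦ b ⟧ vs + s + 1           ≡⟨ shift s (⟦ b ⟧ vs) ⟩
    suc s * suc (⟦ b ⟧ vs)             ≤⟨ *-monoʳ-≤ (suc s) b<a ⟩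
    suc s * ⟦ a ⟧ vs                   ≤⟨ +-cancelʳ-≤ (⟦ R ⟧ vs) _ _ bound ⟩
    suc s * ⟦ b ⟧ vs + s               ∎))
  where
  open ≤-Reasoning
  shift : ∀ s b → suc s * b + s + 1 ≡ suc s * suc b
  shift = solve-∀
  bound : suc s * ⟦ a ⟧ vs + ⟦ R ⟧ vs ≤ suc s * ⟦ b ⟧ vs + s + ⟦ R ⟧ vs
  bound = ≤-trans (≼-sound (suc s :* a :+ R) (suc s :* b :+ con s :+ L) (toWitness ok) vs)
                  (+-monoʳ-≤ (suc s * ⟦ b ⟧ vs + s) L≤R)

-- Pebbling moves

δ-refl : (i : Fin n) → δ i i ≡ 1
δ-refl i with i ≟ i
... | yes _  = refl
... | no i≢i = contradiction refl i≢i

δ-≢ : {i j : Fin n} → i ≢ j → δ i j ≡ 0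
δ-≢ {i = i} {j} i≢j with i ≟ j
... | yes i≡j = contradiction i≡j i≢j
... | no _    = refl

δ≤1 : (i j : Fin n) → δ i j ≤ 1
δ≤1 i j with i ≟ j
... | yes _ = ≤-refl
... | no _  = z≤n

moved-source : (P : Dist n) (u w : Fin n) → moved P u w u ≡ P u ∸ 2
moved-source P u w with u ≟ u
... | yes _  = refl
... | no u≢u = contradiction refl u≢u

moved-target : (P : Dist n) {u w : Fin n} → u ≢ w → moved P u w w ≡ suc (P w)
moved-target P {u} {w} u≢w with u ≟ w | w ≟ w
... | yes u≡w | _      = contradiction u≡w u≢w
... | no _    | yes _  = refl
... | no _    | no w≢w = contradiction refl w≢w

moved-≤ : (P : Dist n) (u : Fin n) {w x : Fin n} → w ≢ x → moved P u w x ≤ P x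
moved-≤ P u {w} {x} w≢x with u ≟ x | w ≟ x
... | yes _ | _       = m∸n≤m (P x) 2
... | no _  | yes w≡x = contradiction w≡x w≢x
... | no _  | no _    = ≤-refl

∸2-mono : ∀ {a b} c → 2 ≤ a → a + c ≤ b → a ∸ 2 + c ≤ b ∸ 2
∸2-mono {a} c 2≤a a+c≤b = ≤-trans (≤-reflexive (Eq.sym (+-∸-comm c 2≤a))) (∸-monoˡ-≤ 2 a+c≤b)

moved-frame : (P P′ : Dist n) (u w : Fin n) {x : Fin n} (q : ℕ) → 2 ≤ P u →
              P x + q ≤ P′ x → moved P u w x + q ≤ moved P′ u w x
moved-frame P P′ u w {x} q 2≤Pu h with u ≟ x | w ≟ x
... | yes refl | _     = ∸2-mono q 2≤Pu h
... | no _     | yes _ = s≤s h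
... | no _     | no _  = h

-- The balance of a move without subtraction, linear in the pebbles so that it can be summed against
-- weights.
moved-δ : (P : Dist n) {u w : Fin n} → u ≢ w → 2 ≤ P u → ∀ x →
          moved P u w x + 2 * δ u x ≡ P x + δ w x
moved-δ P {u} {w} u≢w 2≤Pu x with u ≟ x | w ≟ x
... | yes refl | yes refl = contradiction refl u≢w
... | yes refl | no _     = trans (m∸n+n≡m 2≤Pu) (Eq.sym (+-identityʳ (P u)))
... | no _     | yes _    = trans (+-identityʳ (suc (P x))) (+-comm 1 (P x))
... | no _     | no _     = refl

adj-≢ : (G : Graph n) {u w : Fin n} → adj G u w ≡ true → u ≢ w
adj-≢ G {u} uw refl with trans (Eq.sym (irrefl G u)) uw
... | ()

simple-move : (G : Graph n) (P : Dist n) {u w : Fin n} → adj G u w ≡ true → 2 ≤ P u →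
              Move G P (moved P u w)
simple-move G P {u} {w} uw 2≤Pu = move u w uw 2≤Pu (λ _ → refl)

-- Additional pebbles never block a move, so the same moves can be replayed while `R` lies idle.
frame : (G : Graph n) {P Q P′ : Dist n} (R : Dist n) → G ⊢ P ⇝* Q → (∀ z → P z + R z ≤ P′ z) →
        ∃ λ Q′ → G ⊢ P′ ⇝* Q′ × (∀ z → Q z + R z ≤ Q′ z)
frame G {P′ = P′} R ε h = P′ , ε , h
frame G {P} {P′ = P′} R (move u w uw 2≤Pu eq ◅ ms) h =
  let Q′ , ms′ , h′ = frame G R ms (λ z → subst (λ a → a + R z ≤ moved P′ u w z) (Eq.sym (eq z))
                                               (moved-frame P P′ u w (R z) 2≤Pu (h z)))
  in Q′ , simple-move G P′ uw (≤-trans 2≤Pu (≤-trans (m≤m+n (P u) (R u)) (h u))) ◅ ms′ , h′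

-- The moves for `P` are played with `Q` idle, then those for `Q` with the outcome of the first
-- idle; hence reach is superadditive.
reachable-+ : (G : Graph n) {P Q R : Dist n} {x : Fin n} {j k : ℕ} → (∀ z → P z + Q z ≤ R z) →
              Reachable G P x j → Reachable G Q x k → Reachable G R x (j + k)
reachable-+ G {P} {Q} {R} {x} {j} {k} h (P₁ , P⇝ , j≤) (Q₁ , Q⇝ , k≤) =
  let R₁ , R⇝  , h₁ = frame G Q P⇝ h
      R₂ , R₁⇝ , h₂ = frame G P₁ Q⇝ (λ z → ≤-trans (≤-reflexive (+-comm (Q z) (P₁ z))) (h₁ z))
  in R₂ , R⇝ ◅◅ R₁⇝ ,
     ≤-trans (+-mono-≤ j≤ k≤) (≤-trans (≤-reflexive (+-comm (P₁ x) (Q₁ x))) (h₂ x))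

reachable-mono : (G : Graph n) {P Q : Dist n} {x : Fin n} → (∀ z → P z ≤ Q z) →
                 Reachable G P x k → Reachable G Q x k
reachable-mono {k = k} G {P} {Q} {x} h (P₁ , P⇝ , k≤) =
  let Q₁ , Q⇝ , h₁ = frame G (λ _ → 0) P⇝ (λ z → ≤-trans (≤-reflexive (+-identityʳ (P z))) (h z))
  in Q₁ , Q⇝ , ≤-trans k≤ (≤-trans (≤-reflexive (Eq.sym (+-identityʳ (P₁ x)))) (h₁ x))

pour : (G : Graph n) (P : Dist n) {u w : Fin n} → adj G u w ≡ true → ∀ j → 2 * j ≤ P u →
       ∃ λ Q → G ⊢ P ⇝* Q × P w + j ≤ Q w
pour G P {w = w} uw zero h = P , ε , ≤-reflexive (+-identityʳ (P w))
pour G P {u} {w} uw (suc j) h =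
  let Q , ms , q = pour G (moved P u w) uw j
                     (subst (2 * j ≤_) (Eq.sym (moved-source P u w))
                       (≤-trans (≤-reflexive (Eq.sym (m+n∸n≡m (2 * j) 2)))
                         (∸-monoˡ-≤ 2 (≤-trans (≤-reflexive (double j)) h))))
  in Q , simple-move G P uw (≤-trans (*-monoʳ-≤ 2 (s≤s (z≤n {j}))) h) ◅ ms ,
     ≤-trans (≤-reflexive (+-suc (P w) j)) (subst (λ a → a + j ≤ Q w) (moved-target P (adj-≢ G uw)) q)
  where
  double : ∀ j → 2 * j + 2 ≡ 2 * suc j
  double = solve-∀

reachable-halve : (G : Graph n) {P : Dist n} {x y : Fin n} → adj G x y ≡ true → ∀ {j} →
                  2 * j ≤ k → Reachable G P x k → Reachable G P y j
reachable-halve G {x = x} {y} xy {j} 2j≤k (Q , P⇝ , k≤) =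
  let R , Q⇝ , q = pour G Q xy j (≤-trans 2j≤k k≤)
  in R , P⇝ ◅◅ Q⇝ , ≤-trans (m≤n+m j (Q y)) q

-- Pebbles at y weigh 1 and all others 2: no move increases the total weight.
unit-reach : (G : Graph n) {y x : Fin n} {p : ℕ} → Reachable G (unit y p) x k →
             (if does (y ≟ x) then 1 else 2) * k ≤ p
unit-reach {n} {k} G {y} {x} {p} (Q , ms , k≤) = begin
  a x * k          ≤⟨ *-monoʳ-≤ (a x) k≤ ⟩
  a x * Q x        ≤⟨ Σ-≥ (λ z → a z * Q z) x ⟩
  weight Q         ≤⟨ decreasing ms ⟩
  weight (unit y p) ≡⟨ Σ-cong initial ⟩
  Σᵥ (λ z → p * δ y z) ≡⟨ Σ-δ (λ _ → p) y ⟩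
  p                ∎
  where
  open ≤-Reasoning
  a : Fin n → ℕ
  a z = if does (y ≟ z) then 1 else 2
  weight : Dist n → ℕ
  weight R = Σᵥ (λ z → a z * R z)
  a≥1 : ∀ z → 1 ≤ a z
  a≥1 z with y ≟ z
  ... | yes _ = ≤-refl
  ... | no _  = s≤s z≤n
  a≤2 : ∀ z → a z ≤ 2
  a≤2 z with y ≟ z
  ... | yes _ = s≤s z≤n
  ... | no _  = ≤-refl
  initial : ∀ z → a z * unit y p z ≡ p * δ y z
  initial z with y ≟ z
  ... | yes _ = trans (+-identityʳ p) (Eq.sym (*-identityʳ p))
  ... | no _  = Eq.sym (*-zeroʳ p)
  balance : (R : Dist n) {u w : Fin n} → u ≢ w → 2 ≤ R u →
            weight (moved R u w) + 2 * a u ≡ weight R + a w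
  balance R {u} {w} u≢w 2≤Ru = begin-equality
    weight (moved R u w) + 2 * a u
      ≡⟨ cong (weight (moved R u w) +_) (Eq.sym (Σ-δ (λ z → 2 * a z) u)) ⟩
    weight (moved R u w) + Σᵥ (λ z → 2 * a z * δ u z)
      ≡⟨ Eq.sym (Σ-+ (λ z → a z * moved R u w z) _) ⟩
    Σᵥ (λ z → a z * moved R u w z + 2 * a z * δ u z)
      ≡⟨ Σ-cong (λ z → trans (gather (a z) (moved R u w z) (δ u z))
                        (trans (cong (a z *_) (moved-δ R u≢w 2≤Ru z)) (*-distribˡ-+ (a z) (R z) (δ w z)))) ⟩
    Σᵥ (λ z → a z * R z + a z * δ w z)
      ≡⟨ Σ-+ (λ z → a z * R z) _ ⟩
    weight R + Σᵥ (λ z → a z * δ w z)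
      ≡⟨ cong (weight R +_) (Σ-δ a w) ⟩
    weight R + a w ∎
    where
    gather : ∀ a m d → a * m + 2 * a * d ≡ a * (m + 2 * d)
    gather = solve-∀
  decreasing : {R S : Dist n} → G ⊢ R ⇝* S → weight S ≤ weight R
  decreasing ε = ≤-refl
  decreasing {R} (_◅_ {j = R₁} (move u w uw 2≤Ru eq) ms) = ≤-trans (decreasing ms)
    (+-cancelʳ-≤ (a w) _ _ (begin
      weight R₁ + a w                   ≡⟨ cong (_+ a w) (Σ-cong (λ z → cong (a z *_) (eq z))) ⟩
      weight (moved R u w) + a w        ≤⟨ +-monoʳ-≤ _ (≤-trans (a≤2 w) (*-monoʳ-≤ 2 (a≥1 u))) ⟩
      weight (moved R u w) + 2 * a u    ≡⟨ balance R (adj-≢ G uw) 2≤Ru ⟩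
      weight R + a w                    ∎))

unit-reach-far : (G : Graph n) {y x : Fin n} {p : ℕ} → y ≢ x → Reachable G (unit y p) x k → 2 * k ≤ p
unit-reach-far G {y} {x} y≢x h with y ≟ x | unit-reach G {y} {x} h
... | yes y≡x | _ = contradiction y≡x y≢x
... | no _    | q = q

unit-reach-self : (G : Graph n) {y : Fin n} {p : ℕ} → Reachable G (unit y p) y k → k ≤ p
unit-reach-self {k = k} G {y} h with y ≟ y | unit-reach G {y} {y} h
... | yes _  | q = ≤-trans (≤-reflexive (Eq.sym (+-identityʳ k))) q
... | no y≢y | _ = contradiction refl y≢y

empty-reach : (G : Graph n) {P : Dist n} {x : Fin n} → (∀ z → P z ≡ 0) → Reachable G P x k → k ≡ 0
empty-reach G {x = x} h (Q , ε , k≤) = n≤0⇒n≡0 (≤-trans k≤ (≤-reflexive (h x)))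
empty-reach G h (Q , move u w uw 2≤Pu eq ◅ ms , k≤) with subst (2 ≤_) (h u) 2≤Pu
... | ()

-- Runs collecting pebbles at x without ever moving pebbles out of x

data Run (G : Graph n) (x : Fin n) (k : ℕ) : Dist n → ℕ → Set where
  stop : {P : Dist n} → k ≤ P x → Run G x k P 0
  step : {P : Dist n} (u w : Fin n) → u ≢ x → adj G u w ≡ true → 2 ≤ P u →
         Run G x k (moved P u w) ℓ → Run G x k P (suc ℓ)

moved-gain : {P P′ : Dist n} {u w x : Fin n} {j : ℕ} → u ≢ x →
             P x + j ≤ P′ x → moved P u w x + j ≤ moved P′ u w x
moved-gain {u = u} {w} {x} u≢x h with u ≟ x | w ≟ x
... | yes u≡x | _     = contradiction u≡x u≢x
... | no _    | yes _ = s≤s h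
... | no _    | no _  = h

-- No move of a run leaves `x`, so `j` additional pebbles there stay until the end.
run-gain : (G : Graph n) {x : Fin n} {P P′ : Dist n} {j : ℕ} → Run G x k P ℓ →
           (∀ z → P z ≤ P′ z) → P x + j ≤ P′ x → Run G x (k + j) P′ ℓ
run-gain G {j = j} (stop k≤) h hx = stop (≤-trans (+-monoˡ-≤ j k≤) hx)
run-gain G {x} {P} {P′} {j} (step u w u≢x uw 2≤Pu ρ) h hx =
  step u w u≢x uw (≤-trans 2≤Pu (h u))
    (run-gain G ρ (λ z → subst (_≤ moved P′ u w z) (+-identityʳ _)
                          (moved-frame P P′ u w 0 2≤Pu (≤-trans (≤-reflexive (+-identityʳ (P z))) (h z))))
                  (moved-gain {P = P} {P′} {u} {w} u≢x hx))

-- The first move that the missing pebble blocks is skipped; then a pebble is missing at the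
-- vertex that move would have served.
run-loss : (G : Graph n) {x : Fin n} (w : Fin n) {P P′ : Dist n} → Run G x (suc k) P ℓ →
           (∀ z → P z ≤ P′ z + δ w z) → ∃ λ ℓ′ → ℓ′ ≤ ℓ × Run G x k P′ ℓ′
run-loss {k = k} G {x} w {P} {P′} (stop k<) h = 0 , z≤n , stop
  (s≤s⁻¹ (≤-trans k< (≤-trans (h x) (≤-trans (+-monoʳ-≤ (P′ x) (δ≤1 w x)) (≤-reflexive (+-comm (P′ x) 1))))))
run-loss {k = k} G {x} w {P} {P′} (step u v u≢x uv 2≤Pu ρ) h with 2 ≤? P′ u
... | yes 2≤P′u =
  let ℓ′ , ℓ′≤ , ρ′ = run-loss G w ρ still in suc ℓ′ , s≤s ℓ′≤ , step u v u≢x uv 2≤P′u ρ′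
  where
  still : ∀ z → moved P u v z ≤ moved P′ u v z + δ w z
  still z with u ≟ z | v ≟ z
  ... | yes refl | _     = ≤-trans (∸-monoˡ-≤ 2 (h u)) (≤-reflexive (+-∸-comm (δ w u) 2≤P′u))
  ... | no _     | yes _ = s≤s (h z)
  ... | no _     | no _  = h z
... | no 2≰P′u =
  let ℓ′ , ℓ′≤ , ρ′ = run-loss G v ρ shifted in ℓ′ , m≤n⇒m≤1+n ℓ′≤ , ρ′
  where
  w≡u : w ≡ u
  w≡u with w ≟ u
  ... | yes w≡u = w≡u
  ... | no w≢u  = contradiction
    (≤-trans 2≤Pu (≤-trans (h u) (≤-reflexive (trans (cong (P′ u +_) (δ-≢ w≢u)) (+-identityʳ (P′ u)))))) 2≰P′u
  intact : ∀ z → u ≢ z → P z ≤ P′ z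
  intact z u≢z = ≤-trans (h z)
    (≤-reflexive (trans (cong (P′ z +_) (δ-≢ (λ w≡z → u≢z (trans (Eq.sym w≡u) w≡z)))) (+-identityʳ (P′ z))))
  Pu≤2 : P u ≤ 2
  Pu≤2 = ≤-trans (h u) (+-mono-≤ (s≤s⁻¹ (≰⇒> 2≰P′u)) (δ≤1 w u))
  shifted : ∀ z → moved P u v z ≤ P′ z + δ v z
  shifted z with u ≟ z | v ≟ z
  ... | yes refl | _       = ≤-trans (≤-trans (∸-monoˡ-≤ 2 Pu≤2) z≤n) z≤n
  ... | no u≢z   | yes _   = ≤-trans (s≤s (intact z u≢z)) (≤-reflexive (+-comm 1 (P′ z)))
  ... | no u≢z   | no _    = ≤-trans (intact z u≢z) (m≤m+n (P′ z) 0)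

-- A move out of `x` is dropped instead. Missing the pebble it put on `w` costs the run at most one
-- pebble at `x`, and the two pebbles that `x` does not spend make up for it.
run-prepend : (G : Graph n) {x : Fin n} {P : Dist n} {u w : Fin n} → adj G u w ≡ true → 2 ≤ P u →
              Run G x k (moved P u w) ℓ → ∃ λ ℓ′ → ℓ′ ≤ suc ℓ × Run G x k P ℓ′
run-prepend {k = k} {ℓ} G {x} {P} {u} {w} uw 2≤Pu ρ with u ≟ x
... | no u≢x   = _ , ≤-refl , step u w u≢x uw 2≤Pu ρ
... | yes refl with k
...   | zero   = 0 , z≤n , stop z≤n
...   | suc k′ = ℓ′ , m≤n⇒m≤1+n ℓ′≤ ,
        subst (λ a → Run G u a P ℓ′) (+-comm k′ 1) (run-gain G ρ′ below gain)
  where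
  u≢w = adj-≢ G uw
  lossy = run-loss G w {P′ = λ z → moved P u w z ∸ δ w z} ρ (λ z → m≤n+m∸n′ (moved P u w z) (δ w z))
    where
    m≤n+m∸n′ : ∀ a b → a ≤ a ∸ b + b
    m≤n+m∸n′ a b = ≤-trans (m≤n+m∸n a b) (≤-reflexive (+-comm b (a ∸ b)))
  ℓ′ = proj₁ lossy
  ℓ′≤ = proj₁ (proj₂ lossy)
  ρ′ = proj₂ (proj₂ lossy)
  below : ∀ z → moved P u w z ∸ δ w z ≤ P z
  below z with u ≟ z | w ≟ z
  ... | yes refl | yes refl = contradiction refl u≢w
  ... | yes refl | no _     = m∸n≤m (P u) 2
  ... | no _     | yes _    = ≤-refl
  ... | no _     | no _     = ≤-refl
  gain : moved P u w u ∸ δ w u + 1 ≤ P u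
  gain = begin
    moved P u w u ∸ δ w u + 1  ≤⟨ +-monoˡ-≤ 1 (m∸n≤m (moved P u w u) (δ w u)) ⟩
    moved P u w u + 1          ≡⟨ cong (_+ 1) (moved-source P u w) ⟩
    P u ∸ 2 + 1                ≤⟨ +-monoʳ-≤ (P u ∸ 2) (s≤s z≤n) ⟩
    P u ∸ 2 + 2                ≡⟨ m∸n+n≡m 2≤Pu ⟩
    P u                        ∎
    where open ≤-Reasoning

reachable⇒run : (G : Graph n) {x : Fin n} {P : Dist n} → Reachable G P x k → ∃ λ ℓ → Run G x k P ℓ
reachable⇒run G (Q , ε , k≤) = 0 , stop k≤
reachable⇒run {k = k} G {x} {P} (Q , _◅_ {j = P₁} (move u w uw 2≤Pu eq) ms , k≤) =
  let ℓ , ρ       = reachable⇒run G (Q , ms , k≤)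
      -- `P₁` agrees with `moved P u w` only pointwise; a gain of `0` transports the run.
      ρ₁          = run-gain G {P′ = moved P u w} {j = 0} ρ (λ z → ≤-reflexive (eq z))
                      (≤-reflexive (trans (+-identityʳ (P₁ x)) (eq x)))
      ℓ′ , _ , ρ′ = run-prepend G uw 2≤Pu (subst (λ a → Run G x a (moved P u w) ℓ) (+-identityʳ k) ρ₁)
  in ℓ′ , ρ′

-- A step of a run leads to `moved P u w` itself, so a search over `u` and `w` decides whether a run
-- of given length exists. This is what makes a shortest run available.
run? : (G : Graph n) (x : Fin n) (k : ℕ) (P : Dist n) (ℓ : ℕ) → Dec (Run G x k P ℓ)
run? G x k P zero    = map′ stop (λ { (stop k≤) → k≤ }) (k ≤? P x)
run? {n} G x k P (suc ℓ) = map′ to from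
  (any? λ u → any? λ w → ¬? (u ≟ x) ×-dec (adj G u w Bool.≟ true ×-dec (2 ≤? P u ×-dec run? G x k (moved P u w) ℓ)))
  where
  to : (∃ λ u → ∃ λ w → u ≢ x × adj G u w ≡ true × 2 ≤ P u × Run G x k (moved P u w) ℓ) → Run G x k P (suc ℓ)
  to (u , w , u≢x , uw , 2≤Pu , ρ) = step u w u≢x uw 2≤Pu ρ
  from : Run G x k P (suc ℓ) → ∃ λ u → ∃ λ w → u ≢ x × adj G u w ≡ true × 2 ≤ P u × Run G x k (moved P u w) ℓ
  from (step u w u≢x uw 2≤Pu ρ) = u , w , u≢x , uw , 2≤Pu , ρ

least : {A : ℕ → Set} → (∀ i → Dec (A i)) → ∀ i → A i → ∃ λ j → A j × (∀ i → A i → j ≤ i)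
least {A} A? = <-rec _ λ i rec a → case anyUpTo? A? i of λ where
  (yes (j , j<i , b)) → rec j<i b
  (no none)           → i , a , λ j b → ≮⇒≥ (λ j<i → none (j , j<i , b))

-- Counting the moves into the collecting vertex

inflow : {G : Graph n} {x : Fin n} {P : Dist n} → Run G x k P ℓ → Fin n → ℕ
inflow (stop _) y = 0
inflow {x = x} (step u w _ _ _ ρ) y = δ w x * δ u y + inflow ρ y

δ*δ : (w x u : Fin n) → Σᵥ (λ y → δ w x * δ u y) ≡ δ w x
δ*δ w x u = trans (Σ-* (δ w x) (δ u)) (trans (cong (δ w x *_) (Σ-δ₁ u)) (*-identityʳ (δ w x)))

Σ-inflow-step : {G : Graph n} {x : Fin n} {P : Dist n} (u w : Fin n) (ρ : Run G x k P ℓ) →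
                Σᵥ (λ y → δ w x * δ u y + inflow ρ y) ≡ δ w x + Σᵥ (inflow ρ)
Σ-inflow-step {x = x} u w ρ =
  trans (Σ-+ (λ y → δ w x * δ u y) (inflow ρ)) (cong (_+ Σᵥ (inflow ρ)) (δ*δ w x u))

inflow-adj : {G : Graph n} {x : Fin n} {P : Dist n} (ρ : Run G x k P ℓ) (y : Fin n) →
             1 ≤ inflow ρ y → adj G y x ≡ true
inflow-adj {x = x} (step u w _ uw _ ρ) y h with w ≟ x | u ≟ y
... | yes refl | yes refl = uw
... | yes refl | no _     = inflow-adj ρ y h
... | no _     | _        = inflow-adj ρ y h

inflow-self : {G : Graph n} {x : Fin n} {P : Dist n} (ρ : Run G x k P ℓ) → inflow ρ x ≡ 0
inflow-self {G = G} {x} ρ with inflow ρ x in eq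
... | zero  = refl
... | suc _ = contradiction refl (adj-≢ G (inflow-adj ρ x (subst (1 ≤_) (Eq.sym eq) (s≤s z≤n))))

run-≤-inflow : {G : Graph n} {x : Fin n} {P : Dist n} (ρ : Run G x k P ℓ) → k ≤ P x + Σᵥ (inflow ρ)
run-≤-inflow {P = P} (stop k≤) = ≤-trans k≤ (m≤m+n _ _)
run-≤-inflow {k = k} {x = x} {P} (step u w u≢x uw 2≤Pu ρ) = begin
  k                                           ≤⟨ run-≤-inflow ρ ⟩
  moved P u w x + Σᵥ (inflow ρ)               ≤⟨ +-monoˡ-≤ (Σᵥ (inflow ρ)) arrive ⟩
  P x + δ w x + Σᵥ (inflow ρ)                 ≡⟨ +-assoc (P x) (δ w x) _ ⟩
  P x + (δ w x + Σᵥ (inflow ρ))               ≡⟨ cong (P x +_) (Eq.sym (Σ-inflow-step u w ρ)) ⟩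
  P x + Σᵥ (inflow (step u w u≢x uw 2≤Pu ρ))  ∎
  where
  open ≤-Reasoning
  arrive : moved P u w x ≤ P x + δ w x
  arrive with u ≟ x | w ≟ x
  ... | yes u≡x | _     = contradiction u≡x u≢x
  ... | no _    | yes _ = ≤-reflexive (+-comm 1 (P x))
  ... | no _    | no _  = m≤m+n (P x) 0

-- Suppressing the moves from y to x leaves their 2 · inflow y pebbles on y.
run-skip : {G : Graph n} {x : Fin n} {P P′ : Dist n} (ρ : Run G x k P ℓ) (y : Fin n) (s : ℕ) →
           (∀ z → z ≢ x → P z ≤ P′ z) → P y + 2 * s ≤ P′ y →
           ∃ λ Q → G ⊢ P′ ⇝* Q × 2 * (s + inflow ρ y) ≤ Q y × P′ x + Σᵥ (inflow ρ) ≤ Q x + inflow ρ y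
run-skip {n = n} {x = x} {P} {P′} (stop k≤) y s h hy = P′ , ε ,
  ≤-trans (≤-reflexive (cong (2 *_) (+-identityʳ s))) (≤-trans (m≤n+m (2 * s) (P y)) hy) ,
  ≤-reflexive (cong (P′ x +_) (trans (Σ-const {n} 0) (*-zeroʳ n)))
run-skip {G = G} {x} {P} {P′} ρ₀@(step u w u≢x uw 2≤Pu ρ) y s h hy with (w ≟ x) ×-dec (u ≟ y)
-- The move is suppressed and `s`, the number of suppressed moves so far, grows. `P′` may fall
-- behind at `x`, which is harmless because no move of the run leaves `x`.
... | yes (refl , refl) =
  let Q , ms , q , r = run-skip {P′ = P′} ρ y (suc s)
        (λ z z≢x → ≤-trans (moved-≤ P y (≢-sym z≢x)) (h z z≢x))
        (≤-trans (≤-reflexive (cong (_+ 2 * suc s) (moved-source P y x)))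
          (≤-trans (≤-reflexive (trans (regroup (P y ∸ 2) s) (cong (_+ 2 * s) (m∸n+n≡m 2≤Pu)))) hy))
  in Q , ms ,
     ≤-trans (≤-reflexive (cong (2 *_) (trans (cong (λ d → s + (d + inflow ρ y)) one) (+-suc s _)))) q ,
     ≤-trans (≤-reflexive (trans (cong (P′ x +_) (trans (Σ-inflow-step u w ρ) (cong (_+ Σᵥ (inflow ρ)) (δ-refl x)))) (+-suc _ _)))
       (≤-trans (s≤s r) (≤-reflexive (trans (Eq.sym (+-suc (Q x) _)) (cong (λ d → Q x + (d + inflow ρ y)) (Eq.sym one)))))
  where
  one : δ x x * δ y y ≡ 1
  one = cong₂ _*_ (δ-refl x) (δ-refl y)
  regroup : ∀ a s → a + 2 * suc s ≡ a + 2 + 2 * s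
  regroup = solve-∀
... | no ¬yx =
  let Q , ms , q , r = run-skip {P′ = moved P′ u w} ρ y s
        (λ z z≢x → subst (_≤ moved P′ u w z) (+-identityʳ _)
                     (moved-frame P P′ u w 0 2≤Pu (≤-trans (≤-reflexive (+-identityʳ (P z))) (h z z≢x))))
        (moved-frame P P′ u w (2 * s) 2≤Pu hy)
  in Q , simple-move G P′ uw (≤-trans 2≤Pu (h u u≢x)) ◅ ms ,
     ≤-trans (≤-reflexive (cong (λ d → 2 * (s + (d + inflow ρ y))) none)) q ,
     ≤-trans (≤-reflexive (trans (cong (P′ x +_) (Σ-inflow-step u w ρ))
               (trans (Eq.sym (+-assoc (P′ x) (δ w x) _)) (cong (_+ Σᵥ (inflow ρ)) (Eq.sym arrive)))))
       (≤-trans r (≤-reflexive (cong (λ d → Q x + (d + inflow ρ y)) (Eq.sym none))))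
  where
  none : δ w x * δ u y ≡ 0
  none with w ≟ x | u ≟ y
  ... | yes w≡x | yes u≡y = contradiction (w≡x , u≡y) ¬yx
  ... | yes _   | no _    = refl
  ... | no _    | _       = refl
  arrive : moved P′ u w x ≡ P′ x + δ w x
  arrive with u ≟ x | w ≟ x
  ... | yes u≡x | _     = contradiction u≡x u≢x
  ... | no _    | yes _ = +-comm 1 (P′ x)
  ... | no _    | no _  = Eq.sym (+-identityʳ (P′ x))

-- The run is cut before its first move out of `y`: there `y` holds two pebbles, and the move cut
-- off makes the new run strictly shorter.
run-to-source : {G : Graph n} {x : Fin n} {P : Dist n} (ρ : Run G x k P ℓ) (y : Fin n) →
                1 ≤ inflow ρ y → ∃ λ ℓ′ → ℓ′ < ℓ × Run G y 2 P ℓ′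
run-to-source {G = G} {x} (step u w u≢x uw 2≤Pu ρ) y h with u ≟ y
... | yes refl = 0 , s≤s z≤n , stop 2≤Pu
... | no _     =
  let ℓ₁ , ℓ₁< , ρ₁ = run-to-source ρ y (subst (λ d → 1 ≤ d + inflow ρ y) (*-zeroʳ (δ w x)) h)
      ℓ₂ , ℓ₂≤ , ρ₂ = run-prepend G uw 2≤Pu ρ₁
  in ℓ₂ , ≤-trans (s≤s ℓ₂≤) (s≤s ℓ₁<) , ρ₂

pattern a₀ = var 0F
pattern a₁ = var 1F
pattern a₂ = var 2F
pattern a₃ = var 3F
pattern a₄ = var 4F

¬1≤0 : ∀ {A : Set} → 1 ≤ 0 → A
¬1≤0 ()

-- Discharging

ι : ℕ → ℕ
ι k = if does (1 ≤? k) then 1 else 0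

ι≤1 : ∀ k → ι k ≤ 1
ι≤1 zero    = z≤n
ι≤1 (suc _) = ≤-refl

ι≤ : ∀ k → ι k ≤ k
ι≤ zero    = z≤n
ι≤ (suc _) = s≤s z≤n

≤1⇒≤ι : ∀ {k} → k ≤ 1 → k ≤ ι k
≤1⇒≤ι {zero}  _ = z≤n
≤1⇒≤ι {suc k} p = p

ι-pos : 1 ≤ k → 1 ≤ ι k
ι-pos (s≤s _) = ≤-refl

∸1+ι : ∀ k → k ∸ 1 + ι k ≡ k
∸1+ι zero    = refl
∸1+ι (suc k) = +-comm k 1

-- A vertex with exactly one pebble gets help only where its own budget may fall short, at r ≡ 2 and
-- r ≡ 4: helping it at other values of r would create further payees that supply their payer.
Needy : (p r b k : ℕ) → Set
Needy p r b k = 1 ≤ k × p + k ≡ r × b < r × (p ≢ 1 ⊎ (r ≡ 2 ⊎ r ≡ 4))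

needy? : ∀ p r b k → Dec (Needy p r b k)
needy? p r b k = (1 ≤? k) ×-dec (p + k ℕₚ.≟ r) ×-dec (b <? r) ×-dec
  (¬? (p ℕₚ.≟ 1) ⊎-dec ((r ℕₚ.≟ 2) ⊎-dec (r ℕₚ.≟ 4)))

if-dec : {A : Set} → Dec A → ℕ → ℕ → ℕ
if-dec (yes _) i j = i
if-dec (no _)  i j = j

-- The arguments describe the payee: `m` units reach it, it holds `p` pebbles, has reach `r` and
-- total unit reach `b`, and gets `k` pebbles from the payer. If `m` is `0` it holds none, so
-- `k ≡ r` means a sole supplier.
payment : (m p r b k : ℕ) → ℕ
payment 0 p r b k = if-dec (r ≤? 2) k (if-dec (k ℕₚ.≟ r) 2 0)
payment 1 p r b k = if-dec (needy? p r b k) 1 0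
payment _ p r b k = 0

data PaymentView (m p r b k : ℕ) : ℕ → Set where
  none   : PaymentView m p r b k 0
  small  : m ≡ 0 → r ≤ 2 → 1 ≤ k → PaymentView m p r b k k
  large  : m ≡ 0 → 3 ≤ r → k ≡ r → PaymentView m p r b k 2
  shared : m ≡ 1 → Needy p r b k → PaymentView m p r b k 1

paymentView : ∀ m p r b k → PaymentView m p r b k (payment m p r b k)
paymentView 0 p r b k with r ≤? 2 | k ℕₚ.≟ r
paymentView 0 p r b zero    | yes _   | _       = none
paymentView 0 p r b (suc k) | yes r≤2 | _       = small refl r≤2 (s≤s z≤n)
paymentView 0 p r b k       | no r≰2  | yes k≡r = large refl (≰⇒> r≰2) k≡r
paymentView 0 p r b k       | no _    | no _    = none
paymentView 1 p r b k with needy? p r b k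
... | yes q = shared refl q
... | no _  = none
paymentView (suc (suc m)) p r b k = none

payment-small : ∀ {m} p {r} b k → m ≡ 0 → r ≤ 2 → payment m p r b k ≡ k
payment-small p {r} b k refl r≤2 with r ≤? 2
... | yes _  = refl
... | no r≰2 = contradiction r≤2 r≰2

payment-large : ∀ {m} p {r} b k → m ≡ 0 → 3 ≤ r → k ≡ r → payment m p r b k ≡ 2
payment-large p {r} b k refl 3≤r k≡r with r ≤? 2 | k ℕₚ.≟ r
... | yes r≤2 | _       = contradiction r≤2 (<⇒≱ 3≤r)
... | no _    | yes _   = refl
... | no _    | no k≢r  = contradiction k≡r k≢r

payment-shared : ∀ {m p r b k} → m ≡ 1 → Needy p r b k → payment m p r b k ≡ 1
payment-shared {p = p} {r} {b} {k} refl q with needy? p r b k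
... | yes _ = refl
... | no ¬q = contradiction q ¬q

-- A reach up to `5` rules out `single` givers; from `6` on it is enough to know that a giver is
-- paid at most `1`.
data Size (a : ℕ) : Set where
  one   : a ≡ 1 → Size a
  two   : a ≡ 2 → Size a
  three : a ≡ 3 → Size a
  four  : a ≡ 4 → Size a
  five  : a ≡ 5 → Size a
  big   : 6 ≤ a → Size a

size-of : ∀ {a} → 1 ≤ a → Size a
size-of {1} _ = one refl
size-of {2} _ = two refl
size-of {3} _ = three refl
size-of {4} _ = four refl
size-of {5} _ = five refl
size-of {suc (suc (suc (suc (suc (suc a)))))} _ = big (s≤s (s≤s (s≤s (s≤s (s≤s (s≤s z≤n))))))

-- All that the discharging uses of pebbling. `ρ v x` is the reach of `x` under the unit on `v`,
-- `c x y` the supply from `y` to `x`, and `d` the length of the shortest run, a potential that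
-- keeps two vertices of reach `2` from supplying each other.
record Configuration {n : ℕ} (G : Graph n) (D : ℕ) : Set where
  field
    P r d      : Fin n → ℕ
    ρ c        : Fin n → Fin n → ℕ
    1≤D        : 1 ≤ D
    degree≤    : ∀ x → degree G x ≤ D + 2
    1≤r        : ∀ x → 1 ≤ r x
    base≤r     : ∀ x → Σᵥ (λ v → ρ v x) ≤ r x
    ρ-halve    : ∀ v {x y j} → adj G x y ≡ true → 2 * j ≤ ρ v x → j ≤ ρ v y
    ρ-far      : ∀ {v x} → v ≢ x → 2 * ρ v x ≤ P v
    ρ-self     : ∀ x → ρ x x ≡ P x
    c-total    : ∀ x → P x + Σᵥ (c x) ≡ r x
    c-adj      : ∀ {x y} → 1 ≤ c x y → adj G x y ≡ true
    c-exchange : ∀ {x y} → 1 ≤ c x y → r x + 3 * c x y ≤ 2 * r y + 1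
    c-order    : ∀ {x y} → 1 ≤ c x y → r x ≡ 2 → r y ≡ 2 → d y < d x

module Discharging {n : ℕ} {G : Graph n} {D : ℕ} (C : Configuration G D) where
  open Configuration C

  base m t : Fin n → ℕ
  base x = Σᵥ (λ v → ρ v x)
  m x    = Σᵥ (λ v → ι (ρ v x))
  t x    = Σᵥ (λ v → ρ v x ∸ 1)

  pay : Fin n → Fin n → ℕ
  pay x y = payment (m y) (P y) (r y) (base y) (c y x)

  O I : Fin n → ℕ
  O x = Σᵥ (pay x)
  I x = Σᵥ (λ y → pay y x)

  view : ∀ x y → PaymentView (m y) (P y) (r y) (base y) (c y x) (pay x y)
  view x y = paymentView (m y) (P y) (r y) (base y) (c y x)

  adj-sym : ∀ {x y} → adj G x y ≡ true → adj G y x ≡ true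
  adj-sym {x} {y} xy = trans (Graph.sym G y x) xy

  t+m≡base : ∀ x → t x + m x ≡ base x
  t+m≡base x = trans (Eq.sym (Σ-+ (λ v → ρ v x ∸ 1) (λ v → ι (ρ v x)))) (Σ-cong (λ v → ∸1+ι (ρ v x)))

  m≤base : ∀ x → m x ≤ base x
  m≤base x = Σ-mono (λ v → ι≤ (ρ v x))

  1≤m : ∀ {v x} → 1 ≤ ρ v x → 1 ≤ m x
  1≤m {v} {x} p = ≤-trans (ι-pos p) (Σ-≥ (λ v → ι (ρ v x)) v)

  m≡0⇒¬ : ∀ {v x} → m x ≡ 0 → ¬ (1 ≤ ρ v x)
  m≡0⇒¬ m≡0 p = ¬1≤0 (subst (1 ≤_) m≡0 (1≤m p))

  m≡1-unique : ∀ {v w x} → m x ≡ 1 → 1 ≤ ρ v x → 1 ≤ ρ w x → v ≡ w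
  m≡1-unique {v} {w} {x} m≡1 p q with v ≟ w
  ... | yes v≡w = v≡w
  ... | no v≢w  = contradiction
    (≤-trans (+-mono-≤ (ι-pos p) (ι-pos q))
      (≤-trans (m≤n+m _ (Σᵥ {n} (λ _ → 0))) (≤-trans (Σ-mono-at₂ {g = λ u → ι (ρ u x)} (λ _ → z≤n) v≢w) (≤-reflexive m≡1))))
    (λ { (s≤s ()) })

  -- Every other unit that reaches `x` adds `1` to `m` and at least `1` to `base`.
  ρ+m≤base+1 : ∀ v x → ρ v x + m x ≤ base x + 1
  ρ+m≤base+1 v x = begin
    ρ v x + m x         ≡⟨ +-comm (ρ v x) (m x) ⟩
    m x + ρ v x         ≤⟨ Σ-mono-at (λ w → ι≤ (ρ w x)) v ⟩
    ι (ρ v x) + base x  ≤⟨ +-monoˡ-≤ (base x) (ι≤1 (ρ v x)) ⟩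
    1 + base x          ≡⟨ +-comm 1 (base x) ⟩
    base x + 1          ∎
    where open ≤-Reasoning

  -- Here the other units add equally to `base` and to `m`, so the preceding bound is attained.
  base+1≤ρ+m : ∀ {v x} → 1 ≤ ρ v x → (∀ w → w ≢ v → ρ w x ≤ 1) → base x + 1 ≤ ρ v x + m x
  base+1≤ρ+m {v} {x} p others = begin
    base x + 1                       ≤⟨ +-monoˡ-≤ 1 (Σ-mono pointwise) ⟩
    Σᵥ (λ w → ι (ρ w x) + (ρ v x ∸ 1) * δ v w) + 1
                                     ≡⟨ cong (_+ 1) (trans (Σ-+ (λ w → ι (ρ w x)) _) (cong (m x +_) (Σ-δ (λ _ → ρ v x ∸ 1) v))) ⟩
    m x + (ρ v x ∸ 1) + 1            ≡⟨ +-assoc (m x) (ρ v x ∸ 1) 1 ⟩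
    m x + (ρ v x ∸ 1 + 1)            ≡⟨ cong (m x +_) (m∸n+n≡m p) ⟩
    m x + ρ v x                      ≡⟨ +-comm (m x) (ρ v x) ⟩
    ρ v x + m x                      ∎
    where
    open ≤-Reasoning
    pointwise : ∀ w → ρ w x ≤ ι (ρ w x) + (ρ v x ∸ 1) * δ v w
    pointwise w with v ≟ w
    ... | yes refl = ≤-reflexive (Eq.sym (trans (cong (ι (ρ v x) +_) (*-identityʳ (ρ v x ∸ 1)))
                       (trans (+-comm (ι (ρ v x)) _) (∸1+ι (ρ v x)))))
    ... | no v≢w   = ≤-trans (≤1⇒≤ι (others w (≢-sym v≢w))) (m≤m+n _ _)

  base≤m : ∀ {x} → (∀ v → ρ v x ≤ 1) → base x ≤ m x
  base≤m {x} low = Σ-mono (λ v → ≤1⇒≤ι (low v))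

  P≤base : ∀ x → P x ≤ base x
  P≤base x = subst (_≤ base x) (ρ-self x) (Σ-≥ (λ v → ρ v x) x)

  site-reaches : ∀ {y} → 1 ≤ P y → 1 ≤ ρ y y
  site-reaches {y = y} p = subst (1 ≤_) (Eq.sym (ρ-self y)) p

  site-reaches-neighbour : ∀ {x y j} → adj G y x ≡ true → 2 * j ≤ P y → j ≤ ρ y x
  site-reaches-neighbour {x} {y} yx h = ρ-halve y yx (subst (_ ≤_) (Eq.sym (ρ-self y)) h)

  c≤r : ∀ x y → c x y ≤ r x
  c≤r x y = ≤-trans (Σ-≥ (c x) y) (≤-trans (m≤n+m (Σᵥ (c x)) (P x)) (≤-reflexive (c-total x)))

  -- Bounds on the total that a vertex pays

  a : Fin n → Fin n → ℕ
  a x y = if adj G x y then 1 else 0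

  a-adj : ∀ {x y} → adj G x y ≡ true → a x y ≡ 1
  a-adj xy rewrite xy = refl

  data Paid (x y : Fin n) : Set where
    unpaid : pay x y ≡ 0 → Paid x y
    paid   : 1 ≤ c y x → Paid x y

  pay-c : ∀ x y → Paid x y
  pay-c x y with pay x y in eq | view x y
  ... | .0 | none                     = unpaid eq
  ... | _  | small _ _ p              = paid p
  ... | _  | large _ p q              = paid (≤-trans (≤-trans (s≤s z≤n) p) (≤-reflexive (Eq.sym q)))
  ... | _  | shared _ (p , _)         = paid p

  record Cap (κ : ℕ) (x : Fin n) : Set where
    constructor capped
    field bound : ∀ y → pay x y ≤ κ * a x y
  open Cap

  cap : ∀ {κ x} → (∀ y → 1 ≤ c y x → pay x y ≤ κ) → Cap κ x
  cap {κ} {x} h = capped λ y → bounded y (pay-c x y)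
    where
    bounded : ∀ y → Paid x y → pay x y ≤ κ * a x y
    bounded y (unpaid eq) = subst (_≤ κ * a x y) (Eq.sym eq) z≤n
    bounded y (paid p)    = ≤-trans (h y p) (≤-reflexive (Eq.sym
                              (trans (cong (κ *_) (a-adj (adj-sym (c-adj p)))) (*-identityʳ κ))))

  κΣa≤ : ∀ κ x → Σᵥ (λ y → κ * a x y) ≤ κ * (D + 2)
  κΣa≤ κ x = ≤-trans (≤-reflexive (Σ-* κ (a x))) (*-monoʳ-≤ κ (degree≤ x))

  O≤ : ∀ {κ x} → Cap κ x → O x ≤ κ * (D + 2)
  O≤ {κ} {x} h = ≤-trans (Σ-mono (bound h)) (κΣa≤ κ x)

  -- The cap is charged for all of the at most `D + 2` neighbours except `y`, so an unpaid neighbour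
  -- saves `κ`.
  O-at : ∀ {κ x y} → Cap κ x → adj G x y ≡ true → O x + κ ≤ pay x y + κ * (D + 2)
  O-at {κ} {x} {y} h xy = begin
    O x + κ                         ≡⟨ cong (O x +_) (Eq.sym (trans (cong (κ *_) (a-adj xy)) (*-identityʳ κ))) ⟩
    O x + κ * a x y                 ≤⟨ Σ-mono-at (bound h) y ⟩
    pay x y + Σᵥ (λ z → κ * a x z)  ≤⟨ +-monoʳ-≤ (pay x y) (κΣa≤ κ x) ⟩
    pay x y + κ * (D + 2)           ∎
    where open ≤-Reasoning

  O-at₂ : ∀ {κ x y z} → Cap κ x → y ≢ z → adj G x y ≡ true → adj G x z ≡ true →
          O x + (κ + κ) ≤ pay x y + pay x z + κ * (D + 2)
  O-at₂ {κ} {x} {y} {z} h y≢z xy xz = begin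
    O x + (κ + κ)                             ≡⟨ cong (O x +_) (Eq.sym (cong₂ _+_ (κa xy) (κa xz))) ⟩
    O x + (κ * a x y + κ * a x z)             ≤⟨ Σ-mono-at₂ (bound h) y≢z ⟩
    pay x y + pay x z + Σᵥ (λ z → κ * a x z)  ≤⟨ +-monoʳ-≤ (pay x y + pay x z) (κΣa≤ κ x) ⟩
    pay x y + pay x z + κ * (D + 2)           ∎
    where
    open ≤-Reasoning
    κa : ∀ {w} → adj G x w ≡ true → κ * a x w ≡ κ
    κa xw = trans (cong (κ *_) (a-adj xw)) (*-identityʳ κ)

  -- The local budget `D (r - 1 - t) + m - 1` together with the income covers the payments, all
  -- negative terms being moved across.
  Balanced : Fin n → Set
  Balanced x = suc (D * t x) + O x ≤ D * (r x ∸ 1) + m x + I x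

  -- Since `t = base - m`, the first hypothesis says `t + q ≤ r - 1`: the vertex has a net excess of
  -- at least `q`, worth `q * D`.
  balance : ∀ {x} q → base x + suc q ≤ r x + m x → suc (O x) ≤ q * D + m x + I x → Balanced x
  balance {x} q h O< = begin
    suc (D * t x) + O x                ≡⟨ Eq.sym (+-suc (D * t x) (O x)) ⟩
    D * t x + suc (O x)                ≤⟨ +-monoʳ-≤ (D * t x) O< ⟩
    D * t x + (q * D + m x + I x)      ≡⟨ regroup D (t x) q (m x) (I x) ⟩
    D * (t x + q) + m x + I x          ≤⟨ +-monoˡ-≤ (I x) (+-monoˡ-≤ (m x) (*-monoʳ-≤ D t+q≤)) ⟩
    D * (r x ∸ 1) + m x + I x          ∎
    where
    open ≤-Reasoning
    regroup : ∀ D t q m I → D * t + (q * D + m + I) ≡ D * (t + q) + m + I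
    regroup = solve-∀
    shuffle : ∀ t m q → suc (t + q) + m ≡ t + m + suc q
    shuffle = solve-∀
    t+q≤ : t x + q ≤ r x ∸ 1
    t+q≤ = ∸-monoˡ-≤ 1 (+-cancelʳ-≤ (m x) _ _
      (≤-trans (≤-reflexive (trans (shuffle (t x) (m x) q) (cong (_+ suc q) (t+m≡base x)))) h))

  -- Among the vertices that supply x, only those carrying pebbles of their own can be paid by x,
  -- and those carrying a single pebble only if r x ≡ 6.
  data Giver (x y : Fin n) : Set where
    free   : pay x y ≡ 0 → Giver x y
    site   : pay x y ≡ 1 → m y ≡ 1 → 2 ≤ P y → 1 ≤ c y x → P y + c y x ≡ r y → Giver x y
    single : pay x y ≡ 1 → m y ≡ 1 → P y ≡ 1 → r x ≡ 6 → Giver x y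

  -- The two exchange inequalities force `r x` and `r y` to be `2`, and then each of the shortest
  -- runs would be shorter than the other.
  no-mutual-small : ∀ {x y} → 1 ≤ c x y → 1 ≤ c y x → r y ≤ 2 → ⊥
  no-mutual-small {x} {y} p q r≤2 = <-asym (c-order p rx≡2 ry≡2) (c-order q ry≡2 rx≡2)
    where
    facts : Vec ℕ 4
    facts = r x ∷ r y ∷ c x y ∷ c y x ∷ []
    e₁ e₂ : Fact facts
    e₁ = a₀ :+ 3 :* a₂ ⊑ 2 :* a₁ :+ con 1 by c-exchange p
    e₂ = a₁ :+ 3 :* a₃ ⊑ 2 :* a₀ :+ con 1 by c-exchange q
    pos : Fact facts
    pos = 2 :* con 1 :+ con 1 ⊑ 2 :* a₂ :+ a₃ by +-mono-≤ (*-monoʳ-≤ 2 p) q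
    ry≡2 : r y ≡ 2
    ry≡2 = ≤-antisym r≤2 (farkas 2 (2 ⊠ e₁ ⊞ e₂ ⊞ 3 ⊠ pos) (con 2) a₁)
    rx≡2 : r x ≡ 2
    rx≡2 = ≤-antisym
      (farkas 0 (e₁ ⊞ (2 :* a₁ ⊑ 2 :* con 2 by *-monoʳ-≤ 2 r≤2) ⊞ (3 :* con 1 ⊑ 3 :* a₂ by *-monoʳ-≤ 3 p)) a₀ (con 2))
      (farkas 1 (e₂ ⊞ (con 1 ⊑ a₁ by 1≤r y) ⊞ (3 :* con 1 ⊑ 3 :* a₃ by *-monoʳ-≤ 3 q)) (con 2) a₀)

  -- Exchange at `y` gives `4 * r y ≤ 2 * r x + 1`, whereas exchange at `x` gives
  -- `2 * r x + 4 ≤ 4 * r y`.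
  no-mutual-sole : ∀ {x y} → 1 ≤ c x y → 1 ≤ c y x → c y x ≡ r y → ⊥
  no-mutual-sole {x} {y} p q eq = ¬1≤0 (farkas {vs = r x ∷ r y ∷ c x y ∷ []} 0
    (2 ⊠ (a₀ :+ 3 :* a₂ ⊑ 2 :* a₁ :+ con 1 by c-exchange p)
     ⊞ (a₁ :+ 3 :* a₁ ⊑ 2 :* a₀ :+ con 1 by subst (λ k → r y + 3 * k ≤ 2 * r x + 1) eq (c-exchange q))
     ⊞ 6 ⊠ (con 1 ⊑ a₂ by p))
    (con 1) (con 0))

  giver-shared : ∀ {x y} → 1 ≤ c x y → pay x y ≡ 1 → m y ≡ 1 → ∀ p → P y ≡ p →
                 Needy p (r y) (base y) (c y x) → Giver x y
  giver-shared p eq m≡1 0 _ (q , tot , _)             = ⊥-elim (no-mutual-sole p q tot)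
  giver-shared p eq m≡1 1 _ (q , tot , _ , inj₁ ≢1)   = contradiction refl ≢1
  giver-shared p eq m≡1 1 _ (q , tot , _ , inj₂ (inj₁ r≡2)) = ⊥-elim (no-mutual-small p q (≤-reflexive r≡2))
  -- With `r y ≡ 4` and `c y x ≡ 3` the exchange inequalities read `r x + 3 * c x y ≤ 9` and
  -- `13 ≤ 2 * r x + 1`, which leaves only `r x ≡ 6`.
  giver-shared {x} {y} p eq m≡1 1 eqP (q , tot , _ , inj₂ (inj₂ r≡4)) =
    single eq m≡1 eqP (≤-antisym
      (farkas {vs = facts} 0 ((a₀ :+ 3 :* a₁ ⊑ con 9 by subst (λ k → r x + 3 * c x y ≤ 2 * k + 1) r≡4 (c-exchange p))
                              ⊞ 3 ⊠ (con 1 ⊑ a₁ by p)) a₀ (con 6))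
      (farkas {vs = facts} 1 (con 13 ⊑ 2 :* a₀ :+ con 1 by
        subst₂ (λ b k → b + 3 * k ≤ 2 * r x + 1) r≡4 (suc-injective (trans tot r≡4)) (c-exchange q)) (con 6) a₀))
    where
    facts : Vec ℕ 2
    facts = r x ∷ c x y ∷ []
  giver-shared {x} {y} p eq m≡1 (suc (suc k)) eqP (q , tot , _) =
    site eq m≡1 (subst (2 ≤_) (Eq.sym eqP) (s≤s (s≤s z≤n))) q (trans (cong (_+ c y x) eqP) tot)

  giver : ∀ {x y} → 1 ≤ c x y → Giver x y
  giver {x} {y} p with pay x y in eq | view x y
  ... | .0 | none              = free eq
  ... | _  | small _ r≤2 q     = ⊥-elim (no-mutual-small p q r≤2)
  ... | _  | large _ 3≤r eq′   = ⊥-elim (no-mutual-sole p (≤-trans (≤-trans (s≤s z≤n) 3≤r) (≤-reflexive (Eq.sym eq′))) eq′)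
  ... | .1 | shared m≡1 needy  = giver-shared p eq m≡1 (P y) refl needy

  giver-≤1 : ∀ {x y} → Giver x y → pay x y ≤ 1
  giver-≤1 (free eq)           = ≤-trans (≤-reflexive eq) z≤n
  giver-≤1 (site eq _ _ _ _)   = ≤-reflexive eq
  giver-≤1 (single eq _ _ _)   = ≤-reflexive eq

  6≰5 : ¬ (6 ≤ 5)
  6≰5 (s≤s (s≤s (s≤s (s≤s (s≤s ())))))

  site-supports : ∀ {x y} → adj G x y ≡ true → 2 ≤ P y → 1 ≤ ρ y x
  site-supports xy p = site-reaches-neighbour (adj-sym xy) p

  -- Inserting `2 * ρ y x ≤ P y` and `1 ≤ c y x` into exchange at `y` gives
  -- `2 * ρ y x + 4 ≤ 2 * r x + 1`, and parity does the rest. Hence a vertex paying a site has reach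
  -- at least two above what that site's unit brings.
  site-excess : ∀ {x y} → adj G x y ≡ true → 1 ≤ c y x → P y + c y x ≡ r y → ρ y x + 2 ≤ r x
  site-excess {x} {y} xy q tot = farkas {vs = r x ∷ c y x ∷ P y ∷ ρ y x ∷ []} 1
    ((a₂ :+ a₁ :+ 3 :* a₁ ⊑ 2 :* a₀ :+ con 1 by
        subst (λ b → b + 3 * c y x ≤ 2 * r x + 1) (Eq.sym tot) (c-exchange q))
     ⊞ (2 :* a₃ ⊑ a₂ by ρ-far (≢-sym (adj-≢ G xy)))
     ⊞ 4 ⊠ (con 1 ⊑ a₁ by q))
    (a₃ :+ con 2) a₀

  site-only : ∀ {v y} → m y ≡ 1 → 1 ≤ P y → 1 ≤ ρ v y → v ≡ y
  site-only m≡1 p q = m≡1-unique m≡1 q (site-reaches p)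

  -- A unit bringing two pebbles to `x` reaches `y`, so it would be the unit on `y` itself; but a
  -- single pebble cannot leave its vertex.
  no-single : ∀ {v x y} → adj G x y ≡ true → 2 ≤ ρ v x → m y ≡ 1 → P y ≡ 1 → ⊥
  no-single {v} {x} {y} xy p m≡1 P≡1
    with refl ← site-only m≡1 (≤-reflexive (Eq.sym P≡1)) (ρ-halve v xy p)
    = contradiction (≤-trans (*-monoʳ-≤ 2 p) (≤-trans (ρ-far (≢-sym (adj-≢ G xy))) (≤-reflexive P≡1)))
                    (λ { (s≤s ()) })

  sole-or-two : ∀ {x} → P x < r x →
    (∃ λ y → 1 ≤ c x y × P x + c x y ≡ r x) ⊎ (∃₂ λ y z → y ≢ z × 1 ≤ c x y × 1 ≤ c x z)
  sole-or-two {x} P<r with Σ-concentrated-or-spread (c x) Σ≥1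
    where
    Σ≥1 : 1 ≤ Σᵥ (c x)
    Σ≥1 = +-cancelˡ-≤ (P x) _ _ (≤-trans (≤-reflexive (+-comm (P x) 1)) (≤-trans P<r (≤-reflexive (Eq.sym (c-total x)))))
  ... | inj₁ (y , eq) = inj₁ (y ,
          +-cancelˡ-≤ (P x) _ _ (≤-trans (≤-reflexive (+-comm (P x) 1)) (≤-trans P<r (≤-reflexive (Eq.sym total)))) , total)
    where
    total : P x + c x y ≡ r x
    total = trans (cong (P x +_) eq) (c-total x)
  ... | inj₂ spread = inj₂ spread

  some-giver : ∀ {x} → P x < r x → ∃ λ y → 1 ≤ c x y
  some-giver P<r with sole-or-two P<r
  ... | inj₁ (y , p , _)         = y , p
  ... | inj₂ (y , _ , _ , p , _) = y , p

  -- Exchange would read `r y + 3 * c y x ≤ 3`, so a vertex of reach `1` supplies nobody.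
  cap-0-of-r≡1 : ∀ {x} → r x ≡ 1 → Cap 0 x
  cap-0-of-r≡1 {x} r≡1 = cap λ y p → ¬1≤0 (farkas {vs = r y ∷ c y x ∷ []} 0
    ((a₀ :+ 3 :* a₁ ⊑ con 3 by subst (λ k → r y + 3 * c y x ≤ 2 * k + 1) r≡1 (c-exchange p))
     ⊞ (con 1 ⊑ a₀ by 1≤r y) ⊞ 3 ⊠ (con 1 ⊑ a₁ by p))
    (con 1) (con 0))

  cap-2 : ∀ x → Cap 2 x
  cap-2 x = cap λ y _ → at-most y
    where
    at-most : ∀ y → pay x y ≤ 2
    at-most y with pay x y | view x y
    ... | _ | none          = z≤n
    ... | _ | small _ p _   = ≤-trans (c≤r y x) p
    ... | _ | large _ _ _   = ≤-refl
    ... | _ | shared _ _    = s≤s z≤n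

  -- Only a payee that no unit reaches can get more than `1`. If `r x ≤ 3`, exchange gives
  -- `4 * c y x ≤ 7`, so even that payee gets at most `1`. If a unit brings two pebbles to `x`, it
  -- reaches every neighbour and there is no such payee.
  cap-1 : ∀ {x} → r x ≤ 3 ⊎ (∃ λ v → 2 ≤ ρ v x) → Cap 1 x
  cap-1 {x} h = cap at-most
    where
    few-of : ∀ y → 1 ≤ c y x → m y ≡ 0 → r x ≤ 3 ⊎ (∃ λ v → 2 ≤ ρ v x) → c y x ≤ 1
    few-of y p m≡0 (inj₁ r≤3)     = farkas {vs = r x ∷ r y ∷ c y x ∷ []} 3
      ((a₁ :+ 3 :* a₂ ⊑ 2 :* a₀ :+ con 1 by c-exchange p) ⊞ (a₂ ⊑ a₁ by c≤r y x) ⊞ 2 ⊠ (a₀ ⊑ con 3 by r≤3))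
      a₂ (con 1)
    few-of y p m≡0 (inj₂ (v , q)) = contradiction (ρ-halve v (adj-sym (c-adj p)) q) (m≡0⇒¬ m≡0)
    few : ∀ y → 1 ≤ c y x → m y ≡ 0 → c y x ≤ 1
    few y p m≡0 = few-of y p m≡0 h
    at-most : ∀ y → 1 ≤ c y x → pay x y ≤ 1
    at-most y p with pay x y | view x y
    ... | _ | none            = z≤n
    ... | _ | small m≡0 _ _   = few y p m≡0
    ... | _ | large m≡0 q eq  = contradiction (≤-trans q (≤-trans (≤-reflexive (Eq.sym eq)) (few y p m≡0))) λ { (s≤s ()) }
    ... | _ | shared _ _      = ≤-refl

  O-giver : ∀ {κ x y j} → Cap κ x → 1 ≤ c x y → pay x y ≤ j → O x + κ ≤ j + κ * (D + 2)
  O-giver {κ} h p pay≤ = ≤-trans (O-at h (c-adj p)) (+-monoˡ-≤ (κ * (D + 2)) pay≤)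

  O-givers : ∀ {κ x y z j} → Cap κ x → y ≢ z → 1 ≤ c x y → 1 ≤ c x z → pay x y + pay x z ≤ j →
             O x + (κ + κ) ≤ j + κ * (D + 2)
  O-givers {κ} h y≢z p q pay≤ = ≤-trans (O-at₂ h y≢z (c-adj p) (c-adj q)) (+-monoˡ-≤ (κ * (D + 2)) pay≤)

  vars : Fin n → Vec ℕ 4
  vars x = O x ∷ D ∷ m x ∷ I x ∷ []

  D≥1 : ∀ {x} → Fact (vars x)
  D≥1 = con 1 ⊑ a₁ by 1≤D

  I≥_ : ∀ {x k} → k ≤ I x → Fact (vars x)
  I≥_ {k = k} p = con k ⊑ a₃ by p

  m≥_ : ∀ {x k} → k ≤ m x → Fact (vars x)
  m≥_ {k = k} p = con k ⊑ a₂ by p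

  O+_,_,_ : ∀ {x} i j κ → O x + i ≤ j + κ * (D + 2) → Fact (vars x)
  (O+ i , j , κ) p = a₀ :+ con i ⊑ con j :+ κ :* (a₁ :+ con 2) by p

  -- What remains after granting a net excess of `q` is linear in `O x`, `D`, `m x` and `I x`, so
  -- each case only lists its bounds.
  settle : ∀ {x} q → base x + suc q ≤ r x + m x → (h : Fact (vars x)) →
           {True ((1 :* (con 1 :+ a₀) :+ Fact.rhs h) ≼? (1 :* (q :* a₁ :+ a₂ :+ a₃) :+ con 0 :+ Fact.lhs h))} →
           Balanced x
  settle {x} q b h {ok} = balance q b (farkas 0 h (con 1 :+ a₀) (q :* a₁ :+ a₂ :+ a₃) {ok})

  paid-sole : ∀ {x y} → m x ≡ 1 → Needy (P x) (r x) (base x) (c x y) → 1 ≤ I x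
  paid-sole {x} {y} m≡1 needy =
    ≤-trans (≤-reflexive (Eq.sym (payment-shared m≡1 needy))) (Σ-≥ (λ z → pay z x) y)

  -- The whole reach comes from suppliers. For `r x ≤ 2` each of them pays what it gives, so the
  -- income is `r x`. For larger reach either a sole supplier pays `2`, or two suppliers are paid
  -- less than the cap.
  balanced-0 : ∀ {x} → m x ≡ 0 → Balanced x
  balanced-0 {x} m≡0 = by-size (size-of (1≤r x))
    where
    base≤0 : base x ≤ 0
    base≤0 = ≤-trans (base≤m (λ v → ≤-trans (s≤s⁻¹ (≰⇒> (m≡0⇒¬ {v} m≡0))) z≤n)) (≤-reflexive m≡0)
    P≡0 : P x ≡ 0
    P≡0 = n≤0⇒n≡0 (≤-trans (P≤base x) base≤0)
    P<r : P x < r x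
    P<r = subst (_< r x) (Eq.sym P≡0) (1≤r x)
    budget : ∀ {q} → suc q ≤ r x → base x + suc q ≤ r x + m x
    budget {q} h = ≤-trans (+-mono-≤ base≤0 h) (m≤m+n (r x) (m x))
    free-giver : ∀ {y} → r x ≤ 5 → 1 ≤ c x y → pay x y ≤ 0
    free-giver r≤5 p with giver p
    ... | free eq               = ≤-reflexive eq
    ... | site _ _ q _ _        = contradiction (site-supports (c-adj p) q) (m≡0⇒¬ m≡0)
    ... | single _ _ _ r≡6      = contradiction (≤-trans (≤-reflexive (Eq.sym r≡6)) r≤5) 6≰5
    I-small : r x ≤ 2 → r x ≤ I x
    I-small r≤2 = ≤-reflexive (Eq.sym (trans (Σ-cong (λ y → payment-small (P x) (base x) (c x y) m≡0 r≤2))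
                    (trans (cong (_+ Σᵥ (c x)) (Eq.sym P≡0)) (c-total x))))
    I-sole : ∀ {y} → 3 ≤ r x → P x + c x y ≡ r x → 2 ≤ I x
    I-sole {y} 3≤r tot = ≤-trans (≤-reflexive (Eq.sym (payment-large (P x) (base x) (c x y) m≡0 3≤r
      (trans (cong (_+ c x y) (Eq.sym P≡0)) tot)))) (Σ-≥ (λ z → pay z x) y)
    medium : 4 ≤ r x → r x ≤ 5 → Balanced x
    medium 4≤r r≤5 with sole-or-two P<r
    ... | inj₁ (y , p , tot) = settle 3 (budget 4≤r)
      ((O+ 2 , 0 , 2) (O-giver (cap-2 x) p (free-giver r≤5 p)) ⊞ D≥1 ⊞ I≥ (I-sole (≤-trans (s≤s (s≤s (s≤s z≤n))) 4≤r) tot))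
    ... | inj₂ (y , z , y≢z , p , q) = settle 3 (budget 4≤r)
      ((O+ 4 , 0 , 2) (O-givers (cap-2 x) y≢z p q (+-mono-≤ (free-giver r≤5 p) (free-giver r≤5 q))) ⊞ D≥1)
    by-size : Size (r x) → Balanced x
    by-size (one r≡1) = settle 0 (budget (1≤r x))
      ((O+ 0 , 0 , 0) (≤-trans (≤-reflexive (+-identityʳ (O x))) (O≤ (cap-0-of-r≡1 r≡1)))
       ⊞ I≥ (subst (_≤ I x) r≡1 (I-small (≤-trans (≤-reflexive r≡1) (s≤s z≤n)))))
    by-size (two r≡2) with some-giver P<r
    ... | y , p = settle 1 (budget (≤-reflexive (Eq.sym r≡2)))
      ((O+ 1 , 0 , 1) (O-giver (cap-1 (inj₁ (≤-trans (≤-reflexive r≡2) (n≤1+n 2)))) p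
          (free-giver (≤-trans (≤-reflexive r≡2) (m≤m+n 2 3)) p))
       ⊞ I≥ (subst (_≤ I x) r≡2 (I-small (≤-reflexive r≡2))))
    by-size (three r≡3) with sole-or-two P<r
    ... | inj₁ (y , p , tot) = settle 2 (budget (≤-reflexive (Eq.sym r≡3)))
      ((O+ 1 , 0 , 1) (O-giver (cap-1 (inj₁ (≤-reflexive r≡3))) p (free-giver (≤-trans (≤-reflexive r≡3) (m≤m+n 3 2)) p))
       ⊞ I≥ (I-sole (≤-reflexive (Eq.sym r≡3)) tot))
    ... | inj₂ (y , z , y≢z , p , q) = settle 2 (budget (≤-reflexive (Eq.sym r≡3)))
      ((O+ 2 , 0 , 1) (O-givers (cap-1 (inj₁ (≤-reflexive r≡3))) y≢z p q
          (+-mono-≤ (free-giver (≤-trans (≤-reflexive r≡3) (m≤m+n 3 2)) p)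
                    (free-giver (≤-trans (≤-reflexive r≡3) (m≤m+n 3 2)) q)))
       ⊞ D≥1)
    by-size (four r≡4) = medium (≤-reflexive (Eq.sym r≡4)) (≤-trans (≤-reflexive r≡4) (m≤m+n 4 1))
    by-size (five r≡5) = medium (≤-trans (n≤1+n 4) (≤-reflexive (Eq.sym r≡5))) (≤-reflexive r≡5)
    by-size (big 6≤r) with sole-or-two P<r
    ... | inj₁ (y , p , tot) = settle 5 (budget 6≤r)
      ((O+ 2 , 1 , 2) (O-giver (cap-2 x) p (giver-≤1 (giver p))) ⊞ 3 ⊠ D≥1 ⊞ I≥ (I-sole (≤-trans (s≤s (s≤s (s≤s z≤n))) 6≤r) tot))
    ... | inj₂ (y , z , y≢z , p , q) = settle 5 (budget 6≤r)
      ((O+ 4 , 2 , 2) (O-givers (cap-2 x) y≢z p q (+-mono-≤ (giver-≤1 (giver p)) (giver-≤1 (giver q)))) ⊞ 3 ⊠ D≥1)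

  -- Here `base x` is the contribution of the only unit reaching `x`, and the cases follow the
  -- excess of `r x` over it. Without excess `x` pays nothing; with excess `1` all suppliers are
  -- unpaid; from excess `2` on the budget is at least `2 * D`.
  balanced-1 : ∀ {x} → m x ≡ 1 → Balanced x
  balanced-1 {x} m≡1 = by-excess (m≤n⇒m<n∨m≡n (base≤r x))
    where
    m≥1 : Fact (vars x)
    m≥1 = m≥ ≤-reflexive (Eq.sym m≡1)

    base≡ρ : ∀ {v} → 1 ≤ ρ v x → base x ≡ ρ v x
    base≡ρ {v} p = ≤-antisym
      (+-cancelʳ-≤ 1 _ _ (≤-trans (base+1≤ρ+m p others) (≤-reflexive (cong (ρ v x +_) m≡1))))
      (Σ-≥ (λ w → ρ w x) v)
      where
      others : ∀ w → w ≢ v → ρ w x ≤ 1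
      others w w≢v = ≮⇒≥ λ q → w≢v (m≡1-unique m≡1 (≤-trans (n≤1+n 1) q) p)

    supporter : ∃ λ v → 1 ≤ ρ v x
    supporter with Σ-pos (λ v → ι (ρ v x)) (≤-reflexive (Eq.sym m≡1))
    ... | v , p = v , ≤-trans p (ι≤ (ρ v x))

    P≡1⇒base≡1 : P x ≡ 1 → base x ≡ 1
    P≡1⇒base≡1 P≡1 = trans (base≡ρ (site-reaches (≤-reflexive (Eq.sym P≡1)))) (trans (ρ-self x) P≡1)

    base≥2⇒many : 2 ≤ base x → ∃ λ v → 2 ≤ ρ v x
    base≥2⇒many h with supporter
    ... | v , p = v , subst (2 ≤_) (base≡ρ p) h

    budget : ∀ {q} → base x + q ≤ r x → base x + suc q ≤ r x + m x
    budget {q} h = begin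
      base x + suc q    ≡⟨ +-suc (base x) q ⟩
      suc (base x + q)  ≤⟨ s≤s h ⟩
      suc (r x)         ≡⟨ +-comm 1 (r x) ⟩
      r x + 1           ≡⟨ cong (r x +_) (Eq.sym m≡1) ⟩
      r x + m x         ∎
      where open ≤-Reasoning

    -- The unit attains all of `r x`, which is at least `2` if `x` supplies `y`, so it also reaches
    -- `y`. If `y` holds no pebbles and depends on `x`, then `2 * r y ≤ r x` and the unit alone
    -- attains `r y`; if `y` holds pebbles, the unit is its own and `site-excess` is violated.
    silent : r x ≤ base x → Cap 0 x
    silent r≤base = cap at-most
      where
      r≥2 : ∀ {y} → 1 ≤ c y x → 2 ≤ r x
      r≥2 {y} p = farkas {vs = r x ∷ r y ∷ c y x ∷ []} 1
        ((a₁ :+ 3 :* a₂ ⊑ 2 :* a₀ :+ con 1 by c-exchange p) ⊞ (con 1 ⊑ a₁ by 1≤r y) ⊞ 3 ⊠ (con 1 ⊑ a₂ by p))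
        (con 2) a₀
      ρ≥2 : ∀ {y} → 1 ≤ c y x → 2 ≤ ρ (proj₁ supporter) x
      ρ≥2 p = ≤-trans (r≥2 p) (≤-trans r≤base (≤-reflexive (base≡ρ (proj₂ supporter))))
      r≤ρ : r x ≤ ρ (proj₁ supporter) x
      r≤ρ = ≤-trans r≤base (≤-reflexive (base≡ρ (proj₂ supporter)))
      supports : ∀ {y} → 1 ≤ c y x → 1 ≤ ρ (proj₁ supporter) y
      supports p = ρ-halve _ (adj-sym (c-adj p)) (ρ≥2 p)
      no-needy : ∀ y p → P y ≡ p → m y ≡ 1 → Needy p (r y) (base y) (c y x) → ⊥
      no-needy y 0 _ _ (p , tot , base<r , _) = <⇒≱ base<r (≤-trans
        (ρ-halve _ (adj-sym (c-adj p)) (≤-trans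
          (farkas {vs = r x ∷ r y ∷ []} 1 (a₁ :+ 3 :* a₁ ⊑ 2 :* a₀ :+ con 1 by
             subst (λ k → r y + 3 * k ≤ 2 * r x + 1) tot (c-exchange p)) (2 :* a₁) a₀) r≤ρ))
        (Σ-≥ (λ v → ρ v y) (proj₁ supporter)))
      no-needy y (suc k) eqP my≡1 (p , tot , _)
        with site-only my≡1 (subst (1 ≤_) (Eq.sym eqP) (s≤s z≤n)) (supports p)
      ... | refl = <⇒≱ (m<m+n (ρ y x) (s≤s z≤n))
        (≤-trans (site-excess (adj-sym (c-adj p)) p (trans (cong (_+ c y x) eqP) tot)) r≤ρ)
      at-most : ∀ y → 1 ≤ c y x → pay x y ≤ 0
      at-most y p with pay x y | view x y
      ... | _ | none             = z≤n
      ... | _ | small my≡0 _ _   = contradiction (supports p) (m≡0⇒¬ my≡0)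
      ... | _ | large my≡0 _ _   = contradiction (supports p) (m≡0⇒¬ my≡0)
      ... | _ | shared my≡1 q    = ⊥-elim (no-needy y (P y) refl my≡1 q)

    P<r-of : base x < r x → P x < r x
    P<r-of base<r = ≤-trans (s≤s (P≤base x)) base<r

    -- A paid site `y` reaches `x` by its unit. If `x` holds pebbles, its own unit would be a second
    -- one; otherwise `y` supplies all of `r x`, against `no-mutual-sole`.
    sole-free : ∀ {y} → 1 ≤ c x y → P x + c x y ≡ r x → r x ≢ 6 ⊎ 2 ≤ base x → pay x y ≤ 0
    sole-free {y} p tot h with giver p
    ... | free eq                = ≤-reflexive eq
    ... | single _ my≡1 P≡1 r≡6  = ⊥-elim ([ contradiction r≡6 ,
            (λ b → no-single (c-adj p) (proj₂ (base≥2⇒many b)) my≡1 P≡1) ]′ h)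
    ... | site _ _ 2≤P q _ with P x in eqP
    ...   | zero  = ⊥-elim (no-mutual-sole q p tot)
    ...   | suc _ = contradiction
            (m≡1-unique m≡1 (site-reaches (subst (1 ≤_) (Eq.sym eqP) (s≤s z≤n))) (site-supports (c-adj p) 2≤P))
            (adj-≢ G (c-adj p))

    -- Two paid sites would be two different units reaching `x`.
    two-nearly-free : ∀ {y z} → y ≢ z → 1 ≤ c x y → 1 ≤ c x z → r x ≢ 6 ⊎ 2 ≤ base x → pay x y ≤ 0 ⊎ pay x z ≤ 0
    two-nearly-free y≢z p q h with giver p | giver q
    ... | free eq | _       = inj₁ (≤-reflexive eq)
    ... | _       | free eq = inj₂ (≤-reflexive eq)
    ... | single _ my≡1 P≡1 r≡6 | _ = ⊥-elim ([ contradiction r≡6 ,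
            (λ b → no-single (c-adj p) (proj₂ (base≥2⇒many b)) my≡1 P≡1) ]′ h)
    ... | _ | single _ mz≡1 P≡1 r≡6 = ⊥-elim ([ contradiction r≡6 ,
            (λ b → no-single (c-adj q) (proj₂ (base≥2⇒many b)) mz≡1 P≡1) ]′ h)
    ... | site _ _ Py _ _ | site _ _ Pz _ _ = contradiction
            (m≡1-unique m≡1 (site-supports (c-adj p) Py) (site-supports (c-adj q) Pz)) y≢z

    some-free : base x < r x → r x ≢ 6 ⊎ 2 ≤ base x → ∃ λ y → 1 ≤ c x y × pay x y ≤ 0
    some-free base<r h with sole-or-two (P<r-of base<r)
    ... | inj₁ (y , p , tot)         = y , p , sole-free p tot h
    ... | inj₂ (y , z , y≢z , p , q) with two-nearly-free y≢z p q h
    ...   | inj₁ e = y , p , e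
    ...   | inj₂ e = z , q , e

    few-paid : 1 + base x ≤ r x → Cap 1 x → r x ≢ 6 ⊎ 2 ≤ base x → base x + 2 ≤ r x → Balanced x
    few-paid base<r one-each h base+2≤r with some-free base<r h
    ... | y , p , e = settle 2 (budget base+2≤r) ((O+ 1 , 0 , 1) (O-giver one-each p e) ⊞ m≥1 ⊞ D≥1)

    r≡4-case : base x ≤ 1 → r x ≡ 4 → Balanced x
    r≡4-case base≤1 r≡4 with sole-or-two (P<r-of (≤-trans (s≤s base≤1) (≤-trans (m≤m+n 2 2) (≤-reflexive (Eq.sym r≡4)))))
    ... | inj₁ (y , p , tot) = settle 3 (budget (≤-trans (+-monoˡ-≤ 3 base≤1) (≤-reflexive (Eq.sym r≡4))))
      ((O+ 2 , 0 , 2) (O-giver (cap-2 x) p (sole-free p tot (inj₁ λ r≡6 → case trans (Eq.sym r≡4) r≡6 of λ ())))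
       ⊞ m≥1 ⊞ D≥1
       -- For `D` equal to `1` the other bounds fall short by one. The value `4` in `Needy` secures
       -- this income also when `x` holds a single pebble.
       ⊞ I≥ paid-sole m≡1 (p , tot , ≤-trans (s≤s base≤1) (≤-trans (m≤m+n 2 2) (≤-reflexive (Eq.sym r≡4))) , inj₂ (inj₂ r≡4)))
    ... | inj₂ (y , z , y≢z , p , q) = settle 3 (budget (≤-trans (+-monoˡ-≤ 3 base≤1) (≤-reflexive (Eq.sym r≡4))))
      ((O+ 4 , 1 , 2) (O-givers (cap-2 x) y≢z p q
         (pay-one (two-nearly-free y≢z p q (inj₁ λ r≡6 → case trans (Eq.sym r≡4) r≡6 of λ ()))))
       ⊞ m≥1 ⊞ D≥1)
      where
      pay-one : pay x y ≤ 0 ⊎ pay x z ≤ 0 → pay x y + pay x z ≤ 1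
      pay-one (inj₁ e) = +-mono-≤ e (giver-≤1 (giver q))
      pay-one (inj₂ e) = +-mono-≤ (giver-≤1 (giver p)) e

    r≡5-case : base x ≤ 1 → r x ≡ 5 → Balanced x
    r≡5-case base≤1 r≡5
      with some-free (≤-trans (s≤s base≤1) (≤-trans (m≤m+n 2 3) (≤-reflexive (Eq.sym r≡5))))
                     (inj₁ λ r≡6 → case trans (Eq.sym r≡5) r≡6 of λ ())
    ... | y , p , e = settle 4 (budget (≤-trans (+-monoˡ-≤ 4 base≤1) (≤-reflexive (Eq.sym r≡5))))
      ((O+ 2 , 0 , 2) (O-giver (cap-2 x) p e) ⊞ m≥1 ⊞ 2 ⊠ D≥1)

    large-case : base x ≤ 1 → 6 ≤ r x → Balanced x
    large-case base≤1 6≤r with some-giver (P<r-of (≤-trans (s≤s base≤1) (≤-trans (m≤m+n 2 4) 6≤r)))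
    ... | y , p = settle 5 (budget (≤-trans (+-monoˡ-≤ 5 base≤1) 6≤r))
      ((O+ 2 , 1 , 2) (O-giver (cap-2 x) p (giver-≤1 (giver p))) ⊞ m≥1 ⊞ 3 ⊠ D≥1)

    excess-1 : base x + 1 ≡ r x → Balanced x
    excess-1 eq = by-givers (sole-or-two (P<r-of base<r))
      where
      base<r : base x < r x
      base<r = ≤-reflexive (trans (+-comm 1 (base x)) eq)
      one-each : Cap 1 x
      one-each with 2 ≤? base x
      ... | yes h = cap-1 (inj₂ (base≥2⇒many h))
      ... | no h  = cap-1 (inj₁ (≤-trans (≤-reflexive (Eq.sym eq)) (≤-trans (+-monoˡ-≤ 1 (s≤s⁻¹ (≰⇒> h))) (n≤1+n 2))))
      all-free : ∀ {y} → 1 ≤ c x y → pay x y ≤ 0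
      all-free {y} p with giver p
      ... | free e                 = ≤-reflexive e
      ... | single _ my≡1 P≡1 r≡6  = ⊥-elim (no-single (c-adj p) (proj₂ (base≥2⇒many
              (+-cancelʳ-≤ 1 _ _ (≤-trans (m≤m+n 3 3) (≤-reflexive (trans (Eq.sym r≡6) (Eq.sym eq))))))) my≡1 P≡1)
      ... | site _ _ 2≤P q tot     = contradiction
              (≤-trans (site-excess (c-adj p) q tot)
                (≤-reflexive (trans (Eq.sym eq) (cong (_+ 1) (base≡ρ (site-supports (c-adj p) 2≤P))))))
              (<⇒≱ (+-monoʳ-< (ρ y x) ≤-refl))
      needy-P : P x ≢ 1 ⊎ (r x ≡ 2 ⊎ r x ≡ 4)
      needy-P with P x ℕₚ.≟ 1
      -- A single pebble with excess `1` means reach `2`, the other exceptional value in `Needy`.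
      ... | yes P≡1 = inj₂ (inj₁ (trans (Eq.sym eq) (cong (_+ 1) (P≡1⇒base≡1 P≡1))))
      ... | no P≢1  = inj₁ P≢1
      by-givers : (∃ λ y → 1 ≤ c x y × P x + c x y ≡ r x) ⊎ (∃₂ λ y z → y ≢ z × 1 ≤ c x y × 1 ≤ c x z) → Balanced x
      by-givers (inj₁ (y , p , tot)) = settle 1 (budget (≤-reflexive eq))
        ((O+ 1 , 0 , 1) (O-giver one-each p (all-free p)) ⊞ m≥1 ⊞ I≥ paid-sole m≡1 (p , tot , base<r , needy-P))
      by-givers (inj₂ (y , z , y≢z , p , q)) = settle 1 (budget (≤-reflexive eq))
        ((O+ 2 , 0 , 1) (O-givers one-each y≢z p q (+-mono-≤ (all-free p) (all-free q))) ⊞ m≥1)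

    excess-2 : base x + 2 ≤ r x → Balanced x
    excess-2 h with 2 ≤? base x
    ... | yes many = few-paid (≤-trans (≤-reflexive (+-comm 1 (base x))) (≤-trans (+-monoʳ-≤ (base x) (n≤1+n 1)) h))
                       (cap-1 (inj₂ (base≥2⇒many many))) (inj₂ many) h
    ... | no ¬many = by-size (size-of (1≤r x))
      where
      base≤1 : base x ≤ 1
      base≤1 = s≤s⁻¹ (≰⇒> ¬many)
      r≥3 : 3 ≤ r x
      r≥3 = ≤-trans (+-monoˡ-≤ 2 (≤-trans (≤-reflexive (Eq.sym m≡1)) (m≤base x))) h
      by-size : Size (r x) → Balanced x
      by-size (one r≡1)   = contradiction (subst (3 ≤_) r≡1 r≥3) λ { (s≤s ()) }
      by-size (two r≡2)   = contradiction (subst (3 ≤_) r≡2 r≥3) λ { (s≤s (s≤s ())) }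
      by-size (three r≡3) = few-paid (≤-trans (s≤s base≤1) (≤-trans (n≤1+n 2) r≥3)) (cap-1 (inj₁ (≤-reflexive r≡3)))
                              (inj₁ λ r≡6 → case trans (Eq.sym r≡3) r≡6 of λ ()) h
      by-size (four r≡4)  = r≡4-case base≤1 r≡4
      by-size (five r≡5)  = r≡5-case base≤1 r≡5
      by-size (big 6≤r)   = large-case base≤1 6≤r

    by-excess : base x < r x ⊎ base x ≡ r x → Balanced x
    by-excess (inj₂ eq) = settle 0 (budget (≤-trans (≤-reflexive (+-identityʳ (base x))) (≤-reflexive eq)))
      ((O+ 0 , 0 , 0) (≤-trans (≤-reflexive (+-identityʳ (O x))) (O≤ (silent (≤-reflexive (Eq.sym eq))))) ⊞ m≥1)
    by-excess (inj₁ base<r) with m≤n⇒m<n∨m≡n base<r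
    ... | inj₁ h  = excess-2 (≤-trans (≤-reflexive (+-comm (base x) 2)) h)
    ... | inj₂ eq = excess-1 (trans (+-comm (base x) 1) eq)

  -- If some unit brings two pebbles, payments are at most `1` each; a net excess of `2` covers them
  -- all, and in the tight case, with net excess `1`, the suppliers are unpaid. Otherwise
  -- `base x ≤ m x`, and the net excess is `r x - 1`.
  balanced-2 : ∀ {x} → 2 ≤ m x → Balanced x
  balanced-2 {x} 2≤m with any? (λ v → 2 ≤? ρ v x)
  ... | yes (v , 2≤ρ) = dominated (m≤n⇒m<n∨m≡n (+-mono-≤ (base≤r x) 2≤m))
    where
    one-each : Cap 1 x
    one-each = cap-1 (inj₂ (v , 2≤ρ))
    P<r : P x < r x
    P<r = s≤s⁻¹ (≤-trans (≤-reflexive (+-comm 2 (P x))) (≤-trans (+-mono-≤ (≤-reflexive (Eq.sym (ρ-self x))) 2≤m)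
            (≤-trans (ρ+m≤base+1 x x) (≤-trans (+-monoˡ-≤ 1 (base≤r x)) (≤-reflexive (+-comm (r x) 1))))))
    -- Let `y` be a paid site. Another unit bringing two pebbles to `x` would reach `y` as well, so
    -- `base x + 1 ≤ ρ y x + m x`. With `site-excess` this makes `r x + m x` at least `base x + 3`.
    tight : base x + 2 ≡ r x + m x → ∀ {y} → 1 ≤ c x y → pay x y ≤ 0
    tight eq {y} p with giver p
    ... | free e                = ≤-reflexive e
    ... | single _ my≡1 P≡1 _   = ⊥-elim (no-single (c-adj p) 2≤ρ my≡1 P≡1)
    ... | site _ my≡1 2≤P q tot = ¬1≤0 (farkas {vs = base x ∷ ρ y x ∷ m x ∷ r x ∷ []} 0
        ((a₀ :+ con 1 ⊑ a₁ :+ a₂ by base+1≤ρ+m (site-supports (c-adj p) 2≤P) others)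
         ⊞ (a₁ :+ con 2 ⊑ a₃ by site-excess (c-adj p) q tot)
         ⊞ (a₃ :+ a₂ ⊑ a₀ :+ con 2 by ≤-reflexive (Eq.sym eq)))
        (con 1) (con 0))
      where
      others : ∀ w → w ≢ y → ρ w x ≤ 1
      others w w≢y = ≮⇒≥ λ h → w≢y (site-only my≡1 (≤-trans (n≤1+n 1) 2≤P) (ρ-halve w (c-adj p) h))
    dominated : base x + 2 < r x + m x ⊎ base x + 2 ≡ r x + m x → Balanced x
    dominated (inj₁ h) = settle 2 (≤-trans (≤-reflexive (+-suc (base x) 2)) h)
      ((O+ 0 , 0 , 1) (≤-trans (≤-reflexive (+-identityʳ (O x))) (O≤ one-each)) ⊞ D≥1 ⊞ m≥ 2≤m)
    dominated (inj₂ eq) with some-giver P<r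
    ... | y , p = settle 1 (≤-reflexive eq) ((O+ 1 , 0 , 1) (O-giver one-each p (tight eq p)) ⊞ m≥ 2≤m)
  ... | no ¬many = by-size (size-of (1≤r x))
    where
    low : ∀ v → ρ v x ≤ 1
    low v = ≮⇒≥ λ h → ¬many (v , h)
    m≤r : m x ≤ r x
    m≤r = ≤-trans (m≤base x) (base≤r x)
    P≤1 : P x ≤ 1
    P≤1 = ≤-trans (≤-reflexive (Eq.sym (ρ-self x))) (low x)
    P<r : P x < r x
    P<r = ≤-trans (s≤s P≤1) (≤-trans 2≤m m≤r)
    budget : ∀ {q} → suc q ≤ r x → base x + suc q ≤ r x + m x
    budget {q} h = ≤-trans (+-mono-≤ (base≤m low) h) (≤-reflexive (+-comm (m x) (r x)))
    -- From `P x ≤ 1` follows `c x y ≥ 3`, hence `r y ≥ 6` by exchange. A site `y` holds at most `3`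
    -- pebbles, as `4` would bring two to `x`; so `c y x ≥ 3`, and exchange at `y` would need
    -- `15 ≤ 9`.
    sole-free : ∀ {y} → r x ≡ 4 → 1 ≤ c x y → P x + c x y ≡ r x → pay x y ≤ 0
    sole-free {y} r≡4 p tot with giver p
    ... | free e             = ≤-reflexive e
    ... | single _ _ _ r≡6   = case trans (Eq.sym r≡4) r≡6 of λ ()
    ... | site _ _ 2≤P q tot′ = ¬1≤0 (farkas {vs = r x ∷ P x ∷ c x y ∷ P y ∷ c y x ∷ []} 0
        (2 ⊠ (a₀ :+ 3 :* a₂ ⊑ 2 :* (a₃ :+ a₄) :+ con 1 by
                subst (λ b → r x + 3 * c x y ≤ 2 * b + 1) (Eq.sym tot′) (c-exchange p))
         ⊞ (a₃ :+ a₄ :+ 3 :* a₄ ⊑ 2 :* a₀ :+ con 1 by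
                subst (λ b → b + 3 * c y x ≤ 2 * r x + 1) (Eq.sym tot′) (c-exchange q))
         ⊞ 6 ⊠ (a₀ ⊑ a₁ :+ a₂ by ≤-reflexive (Eq.sym tot))
         ⊞ 6 ⊠ (a₁ ⊑ con 1 by P≤1)
         ⊞ 3 ⊠ (a₃ ⊑ con 3 by s≤s⁻¹ (≰⇒> λ 4≤P →
             <⇒≱ (site-reaches-neighbour (adj-sym (c-adj p)) 4≤P) (low y)))
         ⊞ 6 ⊠ (con 4 ⊑ a₀ by ≤-reflexive (Eq.sym r≡4)))
        (con 1) (con 0))
    large-case : 5 ≤ r x → Balanced x
    large-case 5≤r with some-giver P<r
    ... | y , p = settle 4 (budget 5≤r)
      ((O+ 2 , 1 , 2) (O-giver (cap-2 x) p (giver-≤1 (giver p))) ⊞ m≥ 2≤m ⊞ 2 ⊠ D≥1)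
    by-size : Size (r x) → Balanced x
    by-size (one r≡1) = contradiction (subst (2 ≤_) r≡1 (≤-trans 2≤m m≤r)) λ { (s≤s ()) }
    by-size (two r≡2) with some-giver P<r
    ... | y , p = settle 1 (budget (≤-reflexive (Eq.sym r≡2)))
      ((O+ 1 , 0 , 1) (O-giver (cap-1 (inj₁ (≤-trans (≤-reflexive r≡2) (n≤1+n 2)))) p (is-free (giver p))) ⊞ m≥ 2≤m)
      where
      is-free : Giver x y → pay x y ≤ 0
      is-free (free e)             = ≤-reflexive e
      is-free (single _ _ _ r≡6)   = case trans (Eq.sym r≡2) r≡6 of λ ()
      is-free (site _ _ 2≤P q tot) = contradiction
        (≤-trans (+-monoˡ-≤ 2 (site-supports (c-adj p) 2≤P)) (≤-trans (site-excess (c-adj p) q tot) (≤-reflexive r≡2)))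
        (λ { (s≤s (s≤s ())) })
    by-size (three r≡3) = settle 2 (budget (≤-reflexive (Eq.sym r≡3)))
      ((O+ 0 , 0 , 1) (≤-trans (≤-reflexive (+-identityʳ (O x))) (O≤ (cap-1 (inj₁ (≤-reflexive r≡3))))) ⊞ m≥ 2≤m ⊞ D≥1)
    by-size (four r≡4) with sole-or-two P<r
    ... | inj₁ (y , p , tot) = settle 3 (budget (≤-reflexive (Eq.sym r≡4)))
      ((O+ 2 , 0 , 2) (O-giver (cap-2 x) p (sole-free r≡4 p tot)) ⊞ m≥ 2≤m ⊞ D≥1)
    ... | inj₂ (y , z , y≢z , p , q) = settle 3 (budget (≤-reflexive (Eq.sym r≡4)))
      ((O+ 4 , 2 , 2) (O-givers (cap-2 x) y≢z p q (+-mono-≤ (giver-≤1 (giver p)) (giver-≤1 (giver q)))) ⊞ m≥ 2≤m ⊞ D≥1)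
    by-size (five r≡5) = large-case (≤-reflexive (Eq.sym r≡5))
    by-size (big 6≤r)  = large-case (≤-trans (n≤1+n 5) 6≤r)

  balanced : ∀ x → Balanced x
  balanced x = by-m (m x) refl
    where
    by-m : ∀ i → m x ≡ i → Balanced x
    by-m 0             eq = balanced-0 eq
    by-m 1             eq = balanced-1 eq
    by-m (suc (suc i)) eq = balanced-2 (subst (2 ≤_) (Eq.sym eq) (s≤s (s≤s z≤n)))

  -- Summed over all vertices, income and payments are the same double sum and cancel.
  total-balance : n + D * Σᵥ t ≤ D * Σᵥ (λ x → r x ∸ 1) + Σᵥ m
  total-balance = +-cancelʳ-≤ (Σᵥ O) _ _ (begin
    n + D * Σᵥ t + Σᵥ O                                  ≡⟨ cong (λ s → s + D * Σᵥ t + Σᵥ O) (trans (Eq.sym (*-identityʳ n)) (Eq.sym (Σ-const {n} 1))) ⟩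
    Σᵥ {n} (λ _ → 1) + D * Σᵥ t + Σᵥ O                   ≡⟨ cong (λ s → Σᵥ {n} (λ _ → 1) + s + Σᵥ O) (Eq.sym (Σ-* D t)) ⟩
    Σᵥ {n} (λ _ → 1) + Σᵥ (λ x → D * t x) + Σᵥ O         ≡⟨ cong (_+ Σᵥ O) (Eq.sym (Σ-+ (λ _ → 1) (λ x → D * t x))) ⟩
    Σᵥ (λ x → suc (D * t x)) + Σᵥ O                      ≡⟨ Eq.sym (Σ-+ (λ x → suc (D * t x)) O) ⟩
    Σᵥ (λ x → suc (D * t x) + O x)                       ≤⟨ Σ-mono balanced ⟩
    Σᵥ (λ x → D * (r x ∸ 1) + m x + I x)                 ≡⟨ Σ-+ (λ x → D * (r x ∸ 1) + m x) I ⟩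
    Σᵥ (λ x → D * (r x ∸ 1) + m x) + Σᵥ I                ≡⟨ cong₂ _+_ (Σ-+ (λ x → D * (r x ∸ 1)) m) (Eq.sym (Σ-swap pay)) ⟩
    Σᵥ (λ x → D * (r x ∸ 1)) + Σᵥ m + Σᵥ O               ≡⟨ cong (λ s → s + Σᵥ m + Σᵥ O) (Σ-* D (λ x → r x ∸ 1)) ⟩
    D * Σᵥ (λ x → r x ∸ 1) + Σᵥ m + Σᵥ O                 ∎)
    where open ≤-Reasoning

-- From reach functions to configurations

unit-self : (u : Fin n) (k : ℕ) → unit u k u ≡ k
unit-self u k with u ≟ u
... | yes _  = refl
... | no u≢u = contradiction refl u≢u

unit-0 : (u z : Fin n) → unit u 0 z ≡ 0
unit-0 u z with u ≟ z
... | yes _ = refl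
... | no _  = refl

Σ-units : (P : Dist n) (z : Fin n) → Σᵥ (λ v → unit v (P v) z) ≡ P z
Σ-units P z = trans (Σ-cong at) (Σ-δ P z)
  where
  at : ∀ v → unit v (P v) z ≡ P v * δ z v
  at v with v ≟ z | z ≟ v
  ... | yes _   | yes _   = Eq.sym (*-identityʳ (P v))
  ... | yes v≡z | no z≢v  = contradiction (Eq.sym v≡z) z≢v
  ... | no v≢z  | yes z≡v = contradiction (Eq.sym z≡v) v≢z
  ... | no _    | no _    = Eq.sym (*-zeroʳ (P v))

module Reach {n : ℕ} (G : Graph n) (rch : Dist n → Fin n → ℕ) (isRch : IsReachFn G rch) where

  attains : ∀ P x → Reachable G P x (rch P x)
  attains P x = proj₁ (isRch P x)

  bounds : ∀ {P x k} → Reachable G P x k → k ≤ rch P x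
  bounds {P} {x} = proj₂ (isRch P x) _

  -- `P` is the sum of its units, and reach is superadditive.
  rch-units : ∀ P x → Σᵥ (λ v → rch (unit v (P v)) x) ≤ rch P x
  rch-units P x = bounds (reachable-mono G (λ z → ≤-reflexive (Σ-units P z)) (together (allFin n)))
    where
    together : (vs : List (Fin n)) →
      Reachable G (λ z → sum (map (λ v → unit v (P v) z) vs)) x (sum (map (λ v → rch (unit v (P v)) x) vs))
    together []       = _ , ε , z≤n
    together (v ∷ vs) = reachable-+ G (λ _ → ≤-refl) (attains (unit v (P v)) x) (together vs)

  module Optimal (P : Dist n) where

    shortest : ∀ x → ∃ λ ℓ → Run G x (rch P x) P ℓ × (∀ i → Run G x (rch P x) P i → ℓ ≤ i)
    shortest x = let ℓ , ρ = reachable⇒run G (attains P x) in least (run? G x (rch P x) P) ℓ ρ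

    run : ∀ x → Run G x (rch P x) P (proj₁ (shortest x))
    run x = proj₁ (proj₂ (shortest x))

    total : ∀ x → P x + Σᵥ (inflow (run x)) ≡ rch P x
    total x = ≤-antisym (bounds (Q , P⇝Q , achieved)) (run-≤-inflow (run x))
      where
      -- There are no moves from `x` to itself, so nothing is suppressed: the run is replayed and
      -- the pebbles arriving at `x` are counted.
      skipped = run-skip {P′ = P} (run x) x 0 (λ _ _ → ≤-refl) (≤-reflexive (+-identityʳ (P x)))
      Q = proj₁ skipped
      P⇝Q = proj₁ (proj₂ skipped)
      achieved : P x + Σᵥ (inflow (run x)) ≤ Q x
      achieved = ≤-trans (proj₂ (proj₂ (proj₂ skipped)))
        (≤-reflexive (trans (cong (Q x +_) (inflow-self (run x))) (+-identityʳ (Q x))))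

    -- Keep the pebbles that y would give to x, and send half of what x has anyway back to y.
    exchange : ∀ {x y} → 1 ≤ inflow (run x) y → rch P x + 3 * inflow (run x) y ≤ 2 * rch P y + 1
    exchange {x} {y} p = farkas {vs = rch P x ∷ c ∷ rch P y ∷ Q x ∷ j ∷ Q y ∷ []} 0
      ((var 0F ⊑ var 3F :+ var 1F by ≤-trans (≤-reflexive (Eq.sym (total x))) kept-x)
       ⊞ (2 :* var 1F ⊑ var 5F by kept-y)
       ⊞ (2 :* var 1F ⊑ var 5F by kept-y)
       ⊞ 2 ⊠ (var 5F :+ var 4F ⊑ var 2F by bounds (R , P⇝Q ◅◅ Q⇝R , poured))
       ⊞ (var 3F ⊑ 2 :* var 4F :+ con 1 by upper))
      (var 0F :+ 3 :* var 1F) (2 :* var 2F :+ con 1)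
      where
      c = inflow (run x) y
      skipped = run-skip {P′ = P} (run x) y 0 (λ _ _ → ≤-refl) (≤-reflexive (+-identityʳ (P y)))
      Q = proj₁ skipped
      P⇝Q = proj₁ (proj₂ skipped)
      kept-y : 2 * c ≤ Q y
      kept-y = proj₁ (proj₂ (proj₂ skipped))
      kept-x : P x + Σᵥ (inflow (run x)) ≤ Q x + c
      kept-x = proj₂ (proj₂ (proj₂ skipped))
      j = Q x / 2
      decompose : Q x ≡ Q x % 2 + j * 2
      decompose = m≡m%n+[m/n]*n (Q x) 2
      upper : Q x ≤ 2 * j + 1
      upper = ≤-trans (≤-reflexive decompose) (≤-trans (+-monoˡ-≤ (j * 2) (s≤s⁻¹ (m%n<n (Q x) 2)))
                (≤-reflexive (trans (+-comm 1 (j * 2)) (cong (_+ 1) (*-comm j 2)))))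
      lower : 2 * j ≤ Q x
      lower = ≤-trans (≤-reflexive (*-comm 2 j)) (≤-trans (m≤n+m (j * 2) (Q x % 2)) (≤-reflexive (Eq.sym decompose)))
      pouring = pour G Q (trans (Graph.sym G x y) (inflow-adj (run x) y p)) j lower
      R = proj₁ pouring
      Q⇝R = proj₁ (proj₂ pouring)
      poured : Q y + j ≤ R y
      poured = proj₂ (proj₂ pouring)

    -- Before first using `y`, the run for `x` has two pebbles on `y`, and these are its full reach.
    order : ∀ {x y} → 1 ≤ inflow (run x) y → rch P x ≡ 2 → rch P y ≡ 2 →
            proj₁ (shortest y) < proj₁ (shortest x)
    order {x} {y} p _ ry≡2 =
      let ℓ , ℓ< , ρ = run-to-source (run x) y p
      in ≤-trans (s≤s (proj₂ (proj₂ (shortest y)) ℓ (subst (λ k → Run G y k P ℓ) (Eq.sym ry≡2) ρ))) ℓ<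

    configuration : ∀ {D} → 1 ≤ D → (∀ v → degree G v ≤ D + 2) → Solvable G P → Configuration G D
    configuration 1≤D deg solv = record
      { P          = P
      ; r          = rch P
      ; d          = λ x → proj₁ (shortest x)
      ; ρ          = λ v → rch (unit v (P v))
      ; c          = λ x → inflow (run x)
      ; 1≤D        = 1≤D
      ; degree≤    = deg
      ; 1≤r        = λ x → bounds (solv x)
      ; base≤r     = rch-units P
      ; ρ-halve    = λ v xy h → bounds (reachable-halve G xy h (attains (unit v (P v)) _))
      ; ρ-far      = λ {v} {x} v≢x → unit-reach-far G v≢x (attains (unit v (P v)) x)
      ; ρ-self     = λ x → ≤-antisym (unit-reach-self G (attains (unit x (P x)) x))
                           (bounds (unit x (P x) , ε , ≤-reflexive (Eq.sym (unit-self x (P x)))))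
      ; c-total    = total
      ; c-adj      = λ {x} {y} p → trans (Graph.sym G x y) (inflow-adj (run x) y p)
      ; c-exchange = exchange
      ; c-order    = order
      }

  open WithReach rch public

  TE-null : ∀ {P} → (∀ z → P z ≡ 0) → TE P ≡ 0
  TE-null {P} h = trans (Σ-cong (λ x → cong (_∸ 1) (empty-reach G h (attains P x)))) (trans (Σ-const {n} 0) (*-zeroʳ n))

  cov-null : ∀ {P} → (∀ z → P z ≡ 0) → cov P ≡ 0
  cov-null {P} h = trans (Σ-cong (λ x → cong ι (empty-reach G h (attains P x)))) (trans (Σ-const {n} 0) (*-zeroʳ n))

  TE-mono : ∀ {P Q} → (∀ z → P z ≤ Q z) → TE P ≤ TE Q
  TE-mono {P} h = Σ-mono (λ x → ∸-monoˡ-≤ 1 (bounds (reachable-mono G h (attains P x))))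

-- Sums and distributions along the list of units

sum-unique : (f : Fin n → ℕ) (us : List (Fin n)) → Unique us → (∀ v → v ∉ us → f v ≡ 0) →
             sum (map f us) ≡ Σᵥ f
sum-unique {n} f [] _ h = Eq.sym (trans (Σ-cong (λ v → h v λ ())) (trans (Σ-const {n} 0) (*-zeroʳ n)))
sum-unique f (u ∷ us) (fresh ∷ unique) h = begin
  f u + sum (map f us)         ≡⟨ cong (f u +_) (cong sum (off us fresh)) ⟩
  f u + sum (map (f ∖ u) us)   ≡⟨ cong (f u +_) (sum-unique (f ∖ u) us unique outside) ⟩
  f u + Σᵥ (f ∖ u)             ≡⟨ Eq.sym (Σ-split f u) ⟩
  Σᵥ f                         ∎
  where
  open ≡-Reasoning
  off : ∀ vs → All (u ≢_) vs → map f vs ≡ map (f ∖ u) vs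
  off []       _                = refl
  off (v ∷ vs) (u≢v All.∷ rest) = cong₂ _∷_ (Eq.sym (∖-≢ f u≢v)) (off vs rest)
  outside : ∀ v → v ∉ us → (f ∖ u) v ≡ 0
  outside v v∉us with u ≟ v
  ... | yes _  = refl
  ... | no u≢v = h v λ where
    (here v≡u)   → u≢v (Eq.sym v≡u)
    (there v∈us) → v∉us v∈us

-- Accumulates in the same order as `ceSumFrom`, so that both unfold together in the telescoping.
superpose : Dist n → Dist n → List (Fin n) → Dist n
superpose P acc []       = acc
superpose P acc (u ∷ us) = superpose P (acc ⊕ unit u (P u)) us

superpose-≥acc : (P acc : Dist n) (us : List (Fin n)) (z : Fin n) → acc z ≤ superpose P acc us z
superpose-≥acc P acc []       z = ≤-refl
superpose-≥acc P acc (u ∷ us) z = ≤-trans (m≤m+n (acc z) _) (superpose-≥acc P _ us z)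

superpose-≥ : (P acc : Dist n) {us : List (Fin n)} {z : Fin n} → z ∈ us → P z ≤ superpose P acc us z
superpose-≥ P acc {u ∷ us} {z} (here refl) =
  ≤-trans (≤-trans (≤-reflexive (Eq.sym (unit-self z (P z)))) (m≤n+m _ (acc z))) (superpose-≥acc P _ us z)
superpose-≥ P acc (there z∈us) = superpose-≥ P _ z∈us

-- Telescoping and the final inequality

open import Data.Integer as ℤ using (ℤ; +_)
import Data.Integer.Properties as ℤₚ
import Data.Integer.Tactic.RingSolver as ℤ-Solver

module Telescope {n : ℕ} (rch : Dist n → Fin n → ℕ) where
  open WithReach rch

  teSum : Dist n → List (Fin n) → ℕ
  teSum P us = sum (map (λ u → TE (unit u (P u))) us)

  ceSum-telescopes : ∀ P acc us →
    ceSumFrom P acc us ℤ.+ (+ TE acc ℤ.+ + teSum P us) ≡ + TE (superpose P acc us)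
  ceSum-telescopes P acc []       = trans (ℤₚ.+-identityˡ _) (cong +_ (+-identityʳ (TE acc)))
  ceSum-telescopes P acc (u ∷ us) = trans
    (cancel (+ TE (acc ⊕ unit u (P u))) (+ TE acc) (+ TE (unit u (P u))) (ceSumFrom P (acc ⊕ unit u (P u)) us) (+ teSum P us))
    (ceSum-telescopes P (acc ⊕ unit u (P u)) us)
    where
    cancel : ∀ a′ a b s t → (a′ ℤ.- a ℤ.- b ℤ.+ s) ℤ.+ (a ℤ.+ (b ℤ.+ t)) ≡ s ℤ.+ (a′ ℤ.+ t)
    cancel = ℤ-Solver.solve-∀

theorem5p1 : {n : ℕ} (G : Graph n) (Δ : ℕ) → IsMaxDegree G Δ → 3 ≤ Δ →
    (rch : Dist n → Fin n → ℕ) → IsReachFn G rch →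
    (P : Dist n) → Solvable G P →
    (us : List (Fin n)) → Unique us → (∀ v → (v ∈ us) ⇔ (0 < P v)) →
    Linked (λ a b → P a ≤ P b) us →
    (+ (Δ ∸ 2)) ℤ.* WithReach.ceSum rch P us
    ℤ.≥ (+ n) ℤ.- (+ WithReach.covSum rch P us)
theorem5p1 {n} G Δ (deg , _) 3≤Δ rch isRch P solv us unique support _ =
  from-ℕ (ceSum P us) (+ teSum P us) (+ n) (+ covSum P us) (ceSum-total)
    (subst₂ ℤ._≤_ (cong (λ z → + n ℤ.+ z) (ℤₚ.pos-* D (teSum P us))) (cong (ℤ._+ + covSum P us) (ℤₚ.pos-* D (TE whole)))
       (ℤ.+≤+ counted))
  where
  open Reach G rch isRch
  open Telescope rch
  open Optimal P
  D = Δ ∸ 2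
  D+2≡Δ : D + 2 ≡ Δ
  D+2≡Δ = m∸n+n≡m (≤-trans (n≤1+n 2) 3≤Δ)
  C : Configuration G D
  C = configuration (∸-monoˡ-≤ 2 3≤Δ) (λ v → ≤-trans (deg v) (≤-reflexive (Eq.sym D+2≡Δ))) solv
  whole : Dist n
  whole = superpose P empty us
  P-outside : ∀ v → v ∉ us → P v ≡ 0
  P-outside v v∉us = n<1⇒n≡0 (≰⇒> λ 0<P → v∉us (Equivalence.from (support v) 0<P))
  unit-outside : ∀ v → v ∉ us → ∀ z → unit v (P v) z ≡ 0
  unit-outside v v∉us z = trans (cong (λ k → unit v k z) (P-outside v v∉us)) (unit-0 v z)
  -- Enough for comparing total excesses, because `TE` is monotone.
  P≤whole : ∀ z → P z ≤ whole z
  P≤whole z with 0 <? P z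
  ... | yes 0<P = superpose-≥ P empty (Equivalence.from (support z) 0<P)
  ... | no 0≮P  = ≤-trans (≮⇒≥ 0≮P) z≤n
  te-all : teSum P us ≡ Σᵥ (λ v → TE (unit v (P v)))
  te-all = sum-unique (λ v → TE (unit v (P v))) us unique (λ v v∉us → TE-null (unit-outside v v∉us))
  cov-all : covSum P us ≡ Σᵥ (λ v → cov (unit v (P v)))
  cov-all = sum-unique (λ v → cov (unit v (P v))) us unique (λ v v∉us → cov-null (unit-outside v v∉us))
  counted : n + D * teSum P us ≤ D * TE whole + covSum P us
  counted = begin
    n + D * teSum P us
      ≡⟨ cong (λ s → n + D * s) (trans te-all (Σ-swap (λ v → exc (unit v (P v))))) ⟩
    n + D * Σᵥ (Discharging.t C)
      ≤⟨ Discharging.total-balance C ⟩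
    D * TE P + Σᵥ (Discharging.m C)
      ≤⟨ +-mono-≤ (*-monoʳ-≤ D (TE-mono P≤whole))
           (≤-reflexive (trans (Eq.sym (Σ-swap (λ v x → ι (rch (unit v (P v)) x)))) (Eq.sym cov-all))) ⟩
    D * TE whole + covSum P us ∎
    where open ≤-Reasoning
  ceSum-total : ceSum P us ℤ.+ + teSum P us ≡ + TE whole
  ceSum-total = trans (cong (λ e → ceSum P us ℤ.+ (+ e ℤ.+ + teSum P us)) (Eq.sym (TE-null {empty} (λ _ → refl))))
                      (ceSum-telescopes P empty us)
  from-ℕ : ∀ s e N κ → s ℤ.+ e ≡ + TE whole → N ℤ.+ + D ℤ.* e ℤ.≤ + D ℤ.* + TE whole ℤ.+ κ →
           N ℤ.- κ ℤ.≤ + D ℤ.* s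
  -- Subtracting `D * e + κ` from both sides turns the inequality of natural numbers into the claim.
  from-ℕ s e N κ eq h = subst₂ ℤ._≤_ (left N (+ D ℤ.* e) κ) (trans (cong (λ w → + D ℤ.* w ℤ.+ κ ℤ.- (+ D ℤ.* e ℤ.+ κ)) (Eq.sym eq)) (right (+ D) s e κ))
    (ℤₚ.+-monoˡ-≤ (ℤ.- (+ D ℤ.* e ℤ.+ κ)) h)
    where
    left : ∀ N d κ → N ℤ.+ d ℤ.- (d ℤ.+ κ) ≡ N ℤ.- κ
    left = ℤ-Solver.solve-∀
    right : ∀ D s e κ → D ℤ.* (s ℤ.+ e) ℤ.+ κ ℤ.- (D ℤ.* e ℤ.+ κ) ≡ D ℤ.* s
    right = ℤ-Solver.solve-∀
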